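{- Let $u\le w$ in $\mathbb{P}^*$ under generalized factor order, and let $C: w=v_0\to\dots\to v_n=u$ be a maximal chain of $[u,w]$ with chain id $l_1\cdots l_n$. Then $C(v_i,v_j)$ is a minimally skipped interval of $C$ if and only if one of the following holds: (a) $C(v_i,v_j)$ consists of a single strong descent; or (b) all of the following hold: $v_j$ is a principal factor of $v_i$; $l_{i+1}$ is the principal index of $v_j$ in $v_i$ (positions measured via the embedding of $v_i$ into $w$); and $C[v_i,v_j]$ is the first admissible chain in $[v_j,v_i]$ ending at the prefix embedding of $v_j$.
   Context: $\mathbb{P}=\{1,2,\dots\}$. Generalized factor order on $\mathbb{P}^*$: $u\le w$ iff $u(j)\le w(i+j)$ for all $1\le j\le|u|$, for some $i\ge 0$. Basic notions. - A word is flat if all its letters are $1$. - An embedding of $v$ into $w$ is $\eta\in0^*v0^*$ of length $|w|$ with $\eta(k)\le w(k)$ for all $k$. - In an embedding $\eta$ of $v$, the letter $\eta(k)$ is reducible if $\eta(k)>1$, or $\eta(k)=1$ is the first nonzero letter, or $v$ is not flat and $\eta(k)=1$ is the last nonzero letter. Reducing it subtracts $1$. - In a word $w$, $w(k)$ is reducible if $w(k)>1$, or $w(k)=1$ and $k=1$, or $w(k)=1$, $k=|w|$ and $w$ not flat. Chain ids. A maximal chain determines embeddings $\eta_{v_0}=w$, with $\eta_{v_k}$ obtained from $\eta_{v_{k-1}}$ by reducing the reducible letter at position $l_k$. This chain id is unique to the chain. Chains are ordered lexicographically by chain ids. A chain "ends at" the embedding $\eta_{v_n}$. The first admissible chain ending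 at an embedding $\eta$ of a non-flat word is the maximal chain ending at $\eta$ with lexicographically smallest chain id. - $v_k$ is a descent if $l_k>l_{k+1}$. - A descent is strong if $v_{k-1}\ne v_{k+1}11$. Skipped intervals. $C(v_i,v_j)=\{v_{i+1},\dots,v_{j-1}\}$. A nonempty $C(v_i,v_j)$ is skipped if $C\setminus C(v_i,v_j)\subseteq C'$ for some earlier maximal chain $C'$. It is minimally skipped if it properly contains no skipped interval. Principal factors. - Prefix: $|p|\le|w|$ and $p(k)\le w(k)$ for $k\le|p|$. Suffix: analogous, aligned at the end. Proper: $|p|<|w|$. - Outer factor: both a proper prefix and a proper suffix. Maximal outer factor: not contained in a longer outer factor. - For a non-flat maximal outer factor $p$ of $w$, its principal index is the least $k$ with $w(k)>p(k)$ ($p(k)=0$ for $k>|p|$) and $w(k)$ reducible. - $p$ is a principal factor if lowering $w(k)$ by $1$ gives a word no longer having $p$ as a suffix. -}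

module Defs where

open import Data.Nat using (ℕ; zero; suc; _+_; _∸_; _≤_; _<_)
open import Data.List using (List; []; _∷_; _++_; length; replicate; reverse)
open import Data.List.Relation.Unary.All using (All)
open import Data.Product using (Σ; ∃; ∃-syntax; _×_; _,_)
open import Data.Sum using (_⊎_)
open import Relation.Nullary using (¬_)
open import Relation.Binary.PropositionalEquality using (_≡_; _≢_)

-- Words.  A word over ℙ = {1,2,...} is a list of naturals all ≥ 1.
-- Embeddings are lists of naturals which may contain 0.

Word : Set
Word = List ℕ

IsWord : Word → Set
IsWord w = All (1 ≤_) w

Flat : Word → Set
Flat w = All (_≡ 1) w

-- 1-indexed letter access; value 0 at position 0 and beyond the length
at : List ℕ → ℕ → ℕ
at []       _             = 0
at (x ∷ xs) zero          = 0
at (x ∷ xs) (suc zero)    = x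
at (x ∷ xs) (suc (suc k)) = at xs (suc k)

decAt : List ℕ → ℕ → List ℕ
decAt []       _             = []
decAt (x ∷ xs) zero          = x ∷ xs
decAt (x ∷ xs) (suc zero)    = (x ∸ 1) ∷ xs
decAt (x ∷ xs) (suc (suc k)) = x ∷ decAt xs (suc k)

dropZ : List ℕ → List ℕ
dropZ []          = []
dropZ (zero ∷ xs) = dropZ xs
dropZ (suc x ∷ xs) = suc x ∷ xs

-- remove leading and trailing zeros (the word underlying an embedding)
stripZ : List ℕ → List ℕ
stripZ xs = reverse (dropZ (reverse (dropZ xs)))

lz : List ℕ → ℕ
lz []           = 0
lz (zero ∷ xs)  = suc (lz xs)
lz (suc _ ∷ _)  = 0

_≼_ : Word → Word → Set
u ≼ w = ∃[ i ] (i + length u ≤ length w ×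
          (∀ j → 1 ≤ j → j ≤ length u → at u j ≤ at w (i + j)))

Covers : Word → Word → Set
Covers x y = y ≼ x × y ≢ x ×
  (∀ z → IsWord z → y ≼ z → z ≼ x → (z ≡ y) ⊎ (z ≡ x))

-- Maximal chains of [u,w]:  w = v 0 → v 1 → ... → v n = u, each step a
-- cover.  A chain is given by its length n and v : ℕ → Word (only the
-- values v 0 , ... , v n matter).

IsMaxChain : Word → Word → ℕ → (ℕ → Word) → Set
IsMaxChain u w n v =
  v 0 ≡ w × v n ≡ u ×
  (∀ k → k ≤ n → IsWord (v k)) ×
  (∀ k → k < n → Covers (v k) (v (suc k)))

EmbOf : List ℕ → Word → Set
EmbOf η v = ∃[ a ] ∃[ b ] (η ≡ replicate a 0 ++ v ++ replicate b 0)

RedEmb : List ℕ → Word → ℕ → Set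
RedEmb η v k = 1 ≤ k × k ≤ length η ×
  ( (1 < at η k)
  ⊎ (at η k ≡ 1 × (∀ k' → 1 ≤ k' → k' < k → at η k' ≡ 0))
  ⊎ (¬ Flat v × at η k ≡ 1 × (∀ k' → k < k' → at η k' ≡ 0)) )

RedWord : Word → ℕ → Set
RedWord w k = 1 ≤ k × k ≤ length w ×
  ( (1 < at w k)
  ⊎ (at w k ≡ 1 × k ≡ 1)
  ⊎ (at w k ≡ 1 × k ≡ length w × ¬ Flat w) )

-- Chain ids.  ChainId n v ls η : ls = l_1 ⋯ l_n is the chain id of the
-- chain v 0 → ⋯ → v n, η k being the embedding η_{v_k}
-- (η_{v_0} = v 0, η_{v_{k+1}} obtained from η_{v_k} by reducing the
-- reducible letter at position l_{k+1}).

ChainId : ℕ → (ℕ → Word) → List ℕ → (ℕ → List ℕ) → Set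
ChainId n v ls η =
  length ls ≡ n × η 0 ≡ v 0 ×
  (∀ k → k ≤ n → EmbOf (η k) (v k)) ×
  (∀ k → k < n → RedEmb (η k) (v k) (at ls (suc k)) ×
                 η (suc k) ≡ decAt (η k) (at ls (suc k)))

data LexLt : List ℕ → List ℕ → Set where
  lex-[] : ∀ {y ys} → LexLt [] (y ∷ ys)
  lex-<  : ∀ {x y xs ys} → x < y → LexLt (x ∷ xs) (y ∷ ys)
  lex-≡  : ∀ {x xs ys} → LexLt xs ys → LexLt (x ∷ xs) (x ∷ ys)

LexLe : List ℕ → List ℕ → Set
LexLe xs ys = (xs ≡ ys) ⊎ LexLt xs ys

InInt : (ℕ → Word) → ℕ → ℕ → Word → Set
InInt v i j x = ∃[ k ] (i < k × k < j × v k ≡ x)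

InChain : ℕ → (ℕ → Word) → Word → Set
InChain n v x = ∃[ k ] (k ≤ n × v k ≡ x)

Skipped : Word → Word → ℕ → (ℕ → Word) → List ℕ → ℕ → ℕ → Set
Skipped u w n v ls i j =
  i < j × j ≤ n × (∃[ x ] InInt v i j x) ×
  ∃[ n' ] ∃[ v' ] ∃[ ls' ] ∃[ η' ]
    (IsMaxChain u w n' v' × ChainId n' v' ls' η' × LexLt ls' ls ×
     (∀ x → InChain n v x → ¬ InInt v i j x → InChain n' v' x))

MinSkipped : Word → Word → ℕ → (ℕ → Word) → List ℕ → ℕ → ℕ → Set
MinSkipped u w n v ls i j =
  Skipped u w n v ls i j ×
  (∀ i' j' → Skipped u w n v ls i' j' →
     ¬ ((∀ x → InInt v i' j' x → InInt v i j x) ×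
        (∃[ x ] (InInt v i j x × ¬ InInt v i' j' x))))

Prefix : Word → Word → Set
Prefix p w = length p ≤ length w × (∀ k → 1 ≤ k → k ≤ length p → at p k ≤ at w k)

Suffix : Word → Word → Set
Suffix p w = length p ≤ length w ×
  (∀ k → 1 ≤ k → k ≤ length p → at p k ≤ at w ((length w ∸ length p) + k))

Outer : Word → Word → Set
Outer p w = length p < length w × Prefix p w × Suffix p w

MaxOuter : Word → Word → Set
MaxOuter p w = Outer p w ×
  (∀ q → IsWord q → Outer q w → p ≼ q → ¬ (length p < length q))

IsPrincipalIndex : Word → Word → ℕ → Set
IsPrincipalIndex w p k =
  at p k < at w k × RedWord w k ×
  (∀ k' → k' < k → ¬ (at p k' < at w k' × RedWord w k'))

PrincipalFactor : Word → Word → Set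
PrincipalFactor p w =
  IsWord p × ¬ Flat p × MaxOuter p w ×
  ∃[ k ] (IsPrincipalIndex w p k × ¬ Suffix p (stripZ (decAt w k)))

-- (a) C(v_i,v_j) consists of a single strong descent v_{i+1}
CondA : (ℕ → Word) → List ℕ → ℕ → ℕ → Set
CondA v ls i j =
  j ≡ suc (suc i) ×
  at ls (suc (suc i)) < at ls (suc i) ×
  v i ≢ v (suc (suc i)) ++ (1 ∷ 1 ∷ [])

CondB : ℕ → (ℕ → Word) → List ℕ → (ℕ → List ℕ) → ℕ → ℕ → Set
CondB n v ls η i j =
  PrincipalFactor (v j) (v i) ×
  -- l_{i+1} is the principal index, measured in η_{v_i}
  (∃[ k ] (IsPrincipalIndex (v i) (v j) k × at ls (suc i) ≡ lz (η i) + k)) ×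
  -- C[v_i,v_j] is the first admissible chain in [v_j,v_i] ending at the
  -- prefix embedding of v_j
  (∃[ ls' ] ∃[ η' ]
    (ChainId (j ∸ i) (λ k → v (i + k)) ls' η' ×
     η' (j ∸ i) ≡ v j ++ replicate (length (v i) ∸ length (v j)) 0 ×
     (∀ n₃ v₃ ls₃ η₃ → IsMaxChain (v j) (v i) n₃ v₃ → ChainId n₃ v₃ ls₃ η₃ →
        η₃ n₃ ≡ v j ++ replicate (length (v i) ∸ length (v j)) 0 →
        LexLe ls' ls₃)))

{-# OPTIONS --safe #-}

-- A chain without strong descents reduces letters from left to right and then removes 1s from
-- the right end.  Hence it keeps every reducible letter to the left of its first reduction, and
-- no earlier chain ends at the same embedding.  If [v_j, v_i] contains an earlier chain all the
-- same, that chain ends further right, so it may as well start by reducing the first letter of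
-- v_i: all that matters is that v_j embeds in v_i both as a prefix and at some offset c ≥ 1.
-- If 0 < c < |v_i| - |v_j|, then v_j 1 = v_{j-1} embeds at c too and C(v_i, v_{j-1}) is skipped;
-- if c = |v_i| - |v_j| survives the first reduction, then C(v_{i+1}, v_j) is skipped.  Excluding
-- both is exactly the condition that v_j is a principal factor of v_i.

module Submission where

open import Defs
open import Data.Nat
open import Data.Nat.Properties
open import Data.Nat.ListAction using (sum)
open import Data.Nat.ListAction.Properties using (sum-++)
open import Data.List using (List; []; _∷_; _++_; length; replicate; reverse; map; take)
open import Data.List.Properties using (≡-dec; length-map; length-++; length-replicate; length-reverse; ++-assoc; ++-identityʳ; reverse-++; reverse-involutive; unfold-reverse; ∷-injectiveʳ; ∷-injectiveˡ)
open import Data.List.Relation.Unary.All using (All; []; _∷_)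
open import Data.List.Relation.Unary.All.Properties using (++⁺)
open import Data.Product using (∃-syntax; _×_; _,_; proj₁; proj₂)
open import Data.Sum using (_⊎_; inj₁; inj₂; [_,_]′)
open import Data.Empty using (⊥; ⊥-elim)
open import Function using (_∘_)
open import Function.Bundles using (_⇔_; mk⇔)
open import Relation.Nullary using (¬_; Dec; yes; no; ¬?; _×-dec_)
open import Relation.Binary.Definitions using (tri<; tri≈; tri>)
open import Relation.Binary.PropositionalEquality

-- Skipping speaks of sets of words, chain ids of positions in embeddings. The bridge is that two
-- different reductions of one embedding never give the same word: where two chain ids first differ,
-- the words differ too, so the difference lies inside the skipped interval. Conversely, any earlier
-- detour that ends at some embedding of `v t` can be continued like the given chain, because
-- reducibility is invariant under shifts. Embeddings are therefore handled as functions on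
-- positions that vanish outside the word, and words only up to a shift. The recurring obstacle is
-- flatness. The last 1 of a flat word is not reducible, so two reductions cannot always be
-- interchanged, and an embedding lying below another one is not always reachable from it. It is
-- reachable if it has a letter ≥ 2: this letter separates what is lowered from the left from what
-- is lowered from the right.

Seq : Set
Seq = ℕ → ℕ

-- Letters by position

at-0 : ∀ xs → at xs 0 ≡ 0
at-0 []       = refl
at-0 (_ ∷ _) = refl

at-0∷ : ∀ xs p → at (0 ∷ xs) (suc p) ≡ at xs p
at-0∷ xs zero    = sym (at-0 xs)
at-0∷ xs (suc p) = refl

at-> : ∀ xs p → length xs < p → at xs p ≡ 0
at-> []       p             _        = refl
at-> (x ∷ xs) (suc zero)    (s≤s ())
at-> (x ∷ xs) (suc (suc p)) (s≤s h) = at-> xs (suc p) h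

at-pos⇒≤ : ∀ xs p → 1 ≤ at xs p → p ≤ length xs
at-pos⇒≤ xs p h with p ≤? length xs
... | yes q = q
... | no q  = ⊥-elim (<⇒≢ h (sym (at-> xs p (≰⇒> q))))

at-pos⇒1≤ : ∀ xs p → 1 ≤ at xs p → 1 ≤ p
at-pos⇒1≤ xs zero    h = ⊥-elim (<⇒≢ h (sym (at-0 xs)))
at-pos⇒1≤ xs (suc p) h = s≤s z≤n

at-++-zeros : ∀ v b p → at (v ++ replicate b 0) p ≡ at v p
at-++-zeros []      zero    p             = refl
at-++-zeros []      (suc b) zero          = refl
at-++-zeros []      (suc b) (suc p)       = trans (at-0∷ (replicate b 0) p) (at-++-zeros [] b p)
at-++-zeros (x ∷ v) b       zero          = refl
at-++-zeros (x ∷ v) b       (suc zero)    = refl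
at-++-zeros (x ∷ v) b       (suc (suc p)) = at-++-zeros v b (suc p)

at-snoc-≤ : ∀ v x p → p ≤ length v → at (v ++ x ∷ []) p ≡ at v p
at-snoc-≤ []      x .zero         z≤n     = refl
at-snoc-≤ (y ∷ v) x zero          h       = refl
at-snoc-≤ (y ∷ v) x (suc zero)    h       = refl
at-snoc-≤ (y ∷ v) x (suc (suc p)) (s≤s h) = at-snoc-≤ v x (suc p) h

at-snoc-last : ∀ v x → at (v ++ x ∷ []) (suc (length v)) ≡ x
at-snoc-last []          x = refl
at-snoc-last (y ∷ v) x = at-snoc-last v x

length-snoc : ∀ (v : List ℕ) x → length (v ++ x ∷ []) ≡ suc (length v)
length-snoc v x = trans (length-++ v) (+-comm (length v) 1)

at-ext : ∀ xs ys → length xs ≡ length ys → (∀ p → at xs p ≡ at ys p) → xs ≡ ys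
at-ext []       []       _ _ = refl
at-ext (x ∷ xs) (y ∷ ys) q h =
  cong₂ _∷_ (h 1) (at-ext xs ys (suc-injective q) tails)
  where
  tails : ∀ p → at xs p ≡ at ys p
  tails zero    = trans (at-0 xs) (sym (at-0 ys))
  tails (suc p) = h (suc (suc p))

word-at : ∀ {v} → IsWord v → ∀ p → 1 ≤ p → p ≤ length v → 1 ≤ at v p
word-at (h ∷ hs) (suc zero)    _ _       = h
word-at (h ∷ hs) (suc (suc p)) _ (s≤s q) = word-at hs (suc p) (s≤s z≤n) q

word-length-≤ : ∀ {v} v' → IsWord v → (∀ p → at v p ≤ at v' p) → length v ≤ length v'
word-length-≤ {[]} v' w h = z≤n
word-length-≤ {v@(_ ∷ _)} v' w h =
  at-pos⇒≤ v' (length v) (≤-trans (word-at w (length v) (s≤s z≤n) ≤-refl) (h (length v)))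

word-ext : ∀ {v v'} → IsWord v → IsWord v' → (∀ p → at v p ≡ at v' p) → v ≡ v'
word-ext {v} {v'} w w' h =
  at-ext v v' (≤-antisym (word-length-≤ v' w (λ p → ≤-reflexive (h p)))
                         (word-length-≤ v w' (λ p → ≤-reflexive (sym (h p))))) h

length-decAt : ∀ xs k → length (decAt xs k) ≡ length xs
length-decAt []       k             = refl
length-decAt (x ∷ xs) zero          = refl
length-decAt (x ∷ xs) (suc zero)    = refl
length-decAt (x ∷ xs) (suc (suc k)) = cong suc (length-decAt xs (suc k))

at-decAt-same : ∀ xs k → at (decAt xs k) k ≡ at xs k ∸ 1
at-decAt-same []       k             = refl
at-decAt-same (x ∷ xs) zero          = refl
at-decAt-same (x ∷ xs) (suc zero)    = refl
at-decAt-same (x ∷ xs) (suc (suc k)) = at-decAt-same xs (suc k)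

at-decAt-other : ∀ xs k p → p ≢ k → at (decAt xs k) p ≡ at xs p
at-decAt-other []       k             p             h = refl
at-decAt-other (x ∷ xs) zero          p             h = refl
at-decAt-other (x ∷ xs) (suc zero)    zero          h = refl
at-decAt-other (x ∷ xs) (suc zero)    (suc zero)    h = ⊥-elim (h refl)
at-decAt-other (x ∷ xs) (suc zero)    (suc (suc p)) h = refl
at-decAt-other (x ∷ xs) (suc (suc k)) zero          h = refl
at-decAt-other (x ∷ xs) (suc (suc k)) (suc zero)    h = refl
at-decAt-other (x ∷ xs) (suc (suc k)) (suc (suc p)) h =
  at-decAt-other xs (suc k) (suc p) (h ∘ cong suc)

sum-decAt : ∀ xs k → 1 ≤ at xs k → suc (sum (decAt xs k)) ≡ sum xs
sum-decAt (suc x ∷ xs) (suc zero)    h = refl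
sum-decAt (x ∷ xs)     (suc (suc k)) h =
  trans (sym (+-suc x _)) (cong (x +_) (sum-decAt xs (suc k) h))

-- Nonflat sequences, reductions, contiguity and shifts

NF : Seq → Set
NF f = ∃[ p ] (2 ≤ f p)

-- One notion for words and embeddings: being first or last is read off from the zeros on either
-- side, and nonflatness from a letter ≥ 2, so reducibility does not see how far the word is
-- shifted.
Red : Seq → ℕ → Set
Red f k = (1 < f k)
        ⊎ (f k ≡ 1 × (∀ p → p < k → f p ≡ 0))
        ⊎ (NF f × f k ≡ 1 × (∀ p → k < p → f p ≡ 0))

record Step (f : Seq) (k : ℕ) (g : Seq) : Set where
  constructor mkStep
  field
    red   : Red f k
    here  : f k ≡ suc (g k)
    there : ∀ p → p ≢ k → g p ≡ f p
open Step public

Con : Seq → Set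
Con f = ∀ p q r → p < q → q < r → 1 ≤ f p → 1 ≤ f r → 1 ≤ f q

-- Letters are 1-indexed, so position `a` is still zero and the first letter of `g` sits at `suc a`.
Sh : ℕ → Seq → Seq → Set
Sh a f g = (∀ p → f (a + p) ≡ g p) × (∀ p → p ≤ a → f p ≡ 0)

Rep : Seq → Word → Set
Rep f v = IsWord v × ∃[ a ] Sh a f (at v)

pos≢0 : ∀ {x} → 1 ≤ x → x ≡ 0 → ⊥
pos≢0 h refl = 1+n≰n h

≯0⇒0 : ∀ {x} → ¬ (1 ≤ x) → x ≡ 0
≯0⇒0 {zero}  h = refl
≯0⇒0 {suc x} h = ⊥-elim (h (s≤s z≤n))

≤0 : ∀ {x y} → x ≤ y → y ≡ 0 → x ≡ 0
≤0 h refl = n≤0⇒n≡0 h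

red-pos : ∀ {f k} → Red f k → 1 ≤ f k
red-pos (inj₁ h)                    = <⇒≤ h
red-pos (inj₂ (inj₁ (h , _)))       = ≤-reflexive (sym h)
red-pos (inj₂ (inj₂ (_ , h , _)))   = ≤-reflexive (sym h)

step-decAt : ∀ xs {k} → Red (at xs) k → Step (at xs) k (at (decAt xs k))
step-decAt xs {k} r = mkStep r
  (trans (sym (m+[n∸m]≡n (red-pos r))) (cong suc (sym (at-decAt-same xs k))))
  (λ p → at-decAt-other xs k p)

step-≤ : ∀ {f k g} → Step f k g → ∀ p → g p ≤ f p
step-≤ {k = k} s p with p ≟ k
... | yes refl = ≤-trans (n≤1+n _) (≤-reflexive (sym (here s)))
... | no h     = ≤-reflexive (there s p h)

red-not-first : ∀ {f k q} → Red f k → f k ≡ 1 → q < k → 1 ≤ f q → NF f × (∀ p → k < p → f p ≡ 0)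
red-not-first (inj₁ h)                      e q<k h' = ⊥-elim (<⇒≢ h (sym e))
red-not-first (inj₂ (inj₁ (_ , z)))         e q<k h' = ⊥-elim (pos≢0 h' (z _ q<k))
red-not-first (inj₂ (inj₂ (nf , _ , z)))    e q<k h' = nf , z

-- A letter strictly inside the support is reducible only if it is at least 2, so no gap can open.
step-con : ∀ {f k g} → Step f k g → Con f → Con g
step-con {f} {k} {g} s c p q r p<q q<r gp gr with q ≟ k
... | no h     = subst (1 ≤_) (sym (there s q h)) (c p q r p<q q<r (≤-trans gp (step-≤ s p)) (≤-trans gr (step-≤ s r)))
... | yes refl with red s
...   | inj₁ h = s≤s⁻¹ (subst (2 ≤_) (here s) h)
...   | inj₂ (inj₁ (_ , z)) = ⊥-elim (pos≢0 (≤-trans gp (step-≤ s p)) (z p p<q))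
...   | inj₂ (inj₂ (_ , _ , z)) = ⊥-elim (pos≢0 (≤-trans gr (step-≤ s r)) (z r q<r))

nf-mono : ∀ {f g} → (∀ p → g p ≤ f p) → NF g → NF f
nf-mono h (p , q) = p , ≤-trans q (h p)

split : ∀ a p → p ≤ a ⊎ (∃[ q ] (p ≡ a + suc q))
split a p with p ≤? a
... | yes h = inj₁ h
... | no h  = inj₂ (p ∸ suc a , trans (sym (m+[n∸m]≡n (≰⇒> h))) (sym (+-suc a _)))

sh-pos : ∀ {a f g p} → Sh a f g → 1 ≤ f p → ∃[ q ] (p ≡ a + suc q)
sh-pos {a} {p = p} (_ , z) h with split a p
... | inj₁ p≤a = ⊥-elim (pos≢0 h (z p p≤a))
... | inj₂ r   = r

sh-red↓ : ∀ {a f g k} → Sh a f g → Red f (a + k) → Red g k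
sh-red↓ {a} {f} {g} {k} (s , z) (inj₁ h) = inj₁ (subst (1 <_) (s k) h)
sh-red↓ {a} {f} {g} {k} (s , z) (inj₂ (inj₁ (h , y))) =
  inj₂ (inj₁ (trans (sym (s k)) h , λ p p<k → trans (sym (s p)) (y (a + p) (+-monoʳ-< a p<k))))
sh-red↓ {a} {f} {g} {k} (s , z) (inj₂ (inj₂ ((q , nf) , h , y))) with split a q
... | inj₁ q≤a = ⊥-elim (pos≢0 (<⇒≤ nf) (z q q≤a))
... | inj₂ (r , refl) =
  inj₂ (inj₂ ((suc r , subst (2 ≤_) (s (suc r)) nf) , trans (sym (s k)) h ,
              λ p k<p → trans (sym (s p)) (y (a + p) (+-monoʳ-< a k<p))))

sh-nf : ∀ {a f g} → Sh a f g → NF g → NF f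
sh-nf {a} (s , _) (q , h) = a + q , subst (2 ≤_) (sym (s q)) h

sh-nf↓ : ∀ {a f g} → Sh a f g → NF f → NF g
sh-nf↓ {a} sh@(s , _) (q , h) with sh-pos sh (<⇒≤ h)
... | (r , refl) = suc r , subst (2 ≤_) (s (suc r)) h

sh-red↑ : ∀ {a f g k} → Sh a f g → Red g k → Red f (a + k)
sh-red↑ {k = k} (s , z) (inj₁ h) = inj₁ (subst (1 <_) (sym (s k)) h)
sh-red↑ {a} {f} {g} {k} (s , z) (inj₂ (inj₁ (h , y))) =
  inj₂ (inj₁ (trans (s k) h , first))
  where
  first : ∀ p → p < a + k → f p ≡ 0
  first p p< with split a p
  ... | inj₁ p≤a        = z p p≤a
  ... | inj₂ (q , refl) = trans (s (suc q)) (y (suc q) (+-cancelˡ-< a _ _ p<))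
sh-red↑ {a} {f} {g} {k} (s , z) (inj₂ (inj₂ (nf , h , y))) =
  inj₂ (inj₂ (sh-nf (s , z) nf , trans (s k) h , last))
  where
  last : ∀ p → a + k < p → f p ≡ 0
  last p <p with split a p
  ... | inj₁ p≤a        = z p p≤a
  ... | inj₂ (q , refl) = trans (s (suc q)) (y (suc q) (+-cancelˡ-< a _ _ <p))

sh-step : ∀ {a f g f' g' k} → Sh a f g → Step f (a + k) f' → Step g k g' → Sh a f' g'
sh-step {a} {f} {g} {f'} {g'} {k} (s , z) F G = shift , zeros
  where
  shift : ∀ p → f' (a + p) ≡ g' p
  shift p with p ≟ k
  ... | yes refl = suc-injective (trans (sym (here F)) (trans (s p) (here G)))
  ... | no h     = trans (there F (a + p) (h ∘ +-cancelˡ-≡ a p k)) (trans (s p) (sym (there G p h)))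
  zeros : ∀ p → p ≤ a → f' p ≡ 0
  zeros p h = ≤0 (step-≤ F p) (z p h)

sh-trans : ∀ {a b f g h} → Sh a f g → Sh b g h → Sh (a + b) f h
sh-trans {a} {b} {f} (s , z) (s' , z') =
  (λ p → trans (cong f (+-assoc a b p)) (trans (s (b + p)) (s' p))) , zeros
  where
  zeros : ∀ p → p ≤ a + b → f p ≡ 0
  zeros p h with split a p
  ... | inj₁ p≤a        = z p p≤a
  ... | inj₂ (q , refl) = trans (s (suc q)) (z' (suc q) (+-cancelˡ-≤ a _ _ h))

sh-0 : ∀ xs → Sh 0 (at xs) (at xs)
sh-0 xs = (λ p → refl) , λ { zero z≤n → at-0 xs }

sh-offset : ∀ {a b f g h} → Sh a f g → Sh b f h → 1 ≤ g 1 → b ≤ a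
sh-offset {a} {b} {f} (s , _) (_ , z) p with suc a ≤? b
... | yes q = ⊥-elim (pos≢0 p (trans (sym (s 1)) (z (a + 1) (subst (_≤ b) (+-comm 1 a) q))))
... | no q  = s≤s⁻¹ (≰⇒> q)

sh-all0 : ∀ {a f} → Sh a f (at []) → ∀ p → f p ≡ 0
sh-all0 {a} (s , z) p with split a p
... | inj₁ h          = z p h
... | inj₂ (q , refl) = s (suc q)

all0-word : ∀ {v} → IsWord v → (∀ p → at v p ≡ 0) → v ≡ []
all0-word {[]}    _       _ = refl
all0-word {_ ∷ _} (h ∷ _) z = ⊥-elim (pos≢0 h (z 1))

-- The first letter of a nonempty word pins its offset. The empty word fits every offset and is
-- treated apart.
rep-unique : ∀ {f v v'} → Rep f v → Rep f v' → v ≡ v'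
rep-unique {v = []} (w , a , s) (w' , b , s') =
  sym (all0-word w' (λ p → trans (sym (proj₁ s' p)) (sh-all0 s (b + p))))
rep-unique {v = _ ∷ _} {[]} (w , a , s) (w' , b , s') =
  all0-word w (λ p → trans (sym (proj₁ s p)) (sh-all0 s' (a + p)))
rep-unique {v = _ ∷ _} {_ ∷ _} (w@(h ∷ _) , a , s) (w'@(h' ∷ _) , b , s')
  with refl ← ≤-antisym (sh-offset s s' h) (sh-offset s' s h') =
  word-ext w w' (λ p → trans (sym (proj₁ s p)) (proj₁ s' p))

-- Reducing two different letters never gives the same word

step-0 : ∀ {f k g} → Step f k g → ∀ p → 1 ≤ f p → g p ≡ 0 → p ≡ k
step-0 {k = k} s p h z with p ≟ k
... | yes q = q
... | no q  = ⊥-elim (pos≢0 h (trans (sym (there s p q)) z))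

step-0-val : ∀ {f k g} → Step f k g → g k ≡ 0 → f k ≡ 1
step-0-val s z = trans (here s) (cong suc z)

-- The only candidates are the removals of the first and of the last letter, and these
-- agree only on flat words, whose last letter is not reducible.
reduce-distinct : ∀ {f k g k' g' c c' h} → Con f → Step f k g → Step f k' g' →
                  Sh c g h → Sh c' g' h → 1 ≤ h 1 → k < k' → ⊥
reduce-distinct {f} {k} {g} {k'} {g'} {c} {c'} {h} con S S' sh@(s , z) sh'@(s' , z') h1 k<k'
  with <-cmp c c'
... | tri≈ _ refl _ = 1+n≢n (trans (sym (here S)) (trans (sym (there S' k (<⇒≢ k<k'))) same))
  where
  same : g' k ≡ g k
  same with split c k
  ... | inj₁ k≤c        = trans (z' k k≤c) (sym (z k k≤c))
  ... | inj₂ (q , refl) = trans (s' (suc q)) (sym (s (suc q)))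
-- `g'` starts later than `g`, so position `suc c` is the one removed at `k'`. With `k` to its left
-- it must have been the last letter, but there is still a letter at `suc c'`.
... | tri< c<c' _ _ = pos≢0 fc' (proj₂ (red-not-first (red S') f1 k<k' (red-pos (red S))) (suc c')
                                   (subst (_< suc c') k'≡ (s≤s c<c')))
  where
  gc : 1 ≤ g (suc c)
  gc = subst (1 ≤_) (trans (sym (s 1)) (cong g (+-comm c 1))) h1
  k'≡ : suc c ≡ k'
  k'≡ = step-0 S' (suc c) (≤-trans gc (step-≤ S (suc c))) (z' (suc c) c<c')
  f1 : f k' ≡ 1
  f1 = step-0-val S' (subst (λ x → g' x ≡ 0) k'≡ (z' (suc c) c<c'))
  fc' : 1 ≤ f (suc c')
  fc' = ≤-trans (subst (1 ≤_) (trans (sym (s' 1)) (cong g' (+-comm c' 1))) h1) (step-≤ S' (suc c'))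
... | tri> _ _ c'<c = flat (proj₁ last)
  where
  fc' : 1 ≤ f (suc c')
  fc' = ≤-trans (subst (1 ≤_) (trans (sym (s' 1)) (cong g' (+-comm c' 1))) h1) (step-≤ S' (suc c'))
  fc : 1 ≤ f (suc c)
  fc = ≤-trans (subst (1 ≤_) (trans (sym (s 1)) (cong g (+-comm c 1))) h1) (step-≤ S (suc c))
  k≡ : suc c' ≡ k
  k≡ = step-0 S (suc c') fc' (z (suc c') c'<c)
  fk : f k ≡ 1
  fk = step-0-val S (subst (λ x → g x ≡ 0) k≡ (z (suc c') c'<c))
  c≡ : c ≡ k
  c≡ with <-cmp (suc c') c
  ... | tri≈ _ e _ = trans (sym e) k≡
  ... | tri> _ _ p = ⊥-elim (1+n≰n (≤-trans p c'<c))
  ... | tri< p _ _ = ⊥-elim (pos≢0 (con k (suc k) (suc c) ≤-refl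
            (s≤s (subst (_< c) k≡ p)) (≤-reflexive (sym fk)) fc)
            (trans (sym (there S (suc k) 1+n≢n)) (z (suc k) (subst (_< c) k≡ p))))
  shift : ∀ d → g' (k + d) ≡ g (k + suc d)
  shift d = trans (cong g' (trans (cong (_+ d) (sym k≡)) (sym (+-suc c' d))))
           (trans (s' (suc d)) (trans (sym (s (suc d))) (cong (λ x → g (x + suc d)) c≡)))
  -- `g'` starts at `k`, and `g` has the same letters starting at `suc k`. Hence neighbouring
  -- letters of `f` agree from `k` up to `k'`, and the 1 at `k` spreads.
  ones : ∀ d → k + d ≤ k' → f (k + d) ≡ 1
  ones zero    _ = trans (cong f (+-identityʳ k)) fk
  ones (suc d) h =
    trans (sym (there S (k + suc d) (m+1+n≢m k)))
   (trans (sym (shift d))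
   (trans (there S' (k + d) (<⇒≢ lt)) (ones d (<⇒≤ lt))))
    where
    lt : k + d < k'
    lt = subst (_≤ k') (+-suc k d) h
  ones' : ∀ p → k ≤ p → p ≤ k' → f p ≡ 1
  ones' p k≤p p≤k' = trans (cong f (sym (m+[n∸m]≡n k≤p)))
                           (ones (p ∸ k) (subst (_≤ k') (sym (m+[n∸m]≡n k≤p)) p≤k'))
  last : NF f × (∀ p → k' < p → f p ≡ 0)
  last = red-not-first (red S') (ones' k' (<⇒≤ k<k') ≤-refl) k<k' (red-pos (red S))
  flat : NF f → ⊥
  flat (p , h2) with p <? k
  ... | yes p<k = pos≢0 (<⇒≤ h2) (trans (sym (there S' p (<⇒≢ (<-trans p<k k<k'))))
                                       (z' p (s≤s⁻¹ (subst (p <_) (sym k≡) p<k))))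
  ... | no p≮k with p ≤? k'
  ...   | yes p≤k' = <⇒≢ h2 (sym (ones' p (≮⇒≥ p≮k) p≤k'))
  ...   | no p≰k'  = pos≢0 (<⇒≤ h2) (proj₂ last p (≰⇒> p≰k'))

-- For locating an earlier chain: if it reduces another letter of the same embedding, its next word
-- is different as well.
step-unique : ∀ {f k g k' g' v} → Con f → Step f k g → Step f k' g' → Rep g v → Rep g' v → k ≡ k'
step-unique {k = k} {k' = k'} {v = []} con S S' (_ , _ , s) (_ , _ , s') with k ≟ k'
... | yes e = e
... | no ne = ⊥-elim (pos≢0 (red-pos (red S)) (trans (sym (there S' k ne)) (sh-all0 s' k)))
step-unique {k = k} {k' = k'} {v = _ ∷ _} con S S' (h ∷ _ , _ , s) (_ , _ , s') with <-cmp k k'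
... | tri≈ _ e _ = e
... | tri< p _ _ = ⊥-elim (reduce-distinct con S S' s s' h p)
... | tri> _ _ p = ⊥-elim (reduce-distinct con S' S s' s h p)

-- Descents

-- The two steps remove a trailing 11: the descents that are not strong.
TT : Seq → ℕ → ℕ → Set
TT f a b = a ≡ suc b × f a ≡ 1 × f b ≡ 1 × (∀ p → a < p → f p ≡ 0)

-- Only the last-letter clause can depend on the first step: `b` may have become last through the
-- removal of `a`. By contiguity `a` is then its right neighbour, and the two form a trailing 11.
swap-red : ∀ {f a g b h} → Con f → Step f a g → Step g b h → b < a → ¬ TT f a b → Red f b
swap-red {f} {a} {g} {b} con S S' b<a ¬tt with red S'
... | inj₁ h = inj₁ (subst (1 <_) (there S b (<⇒≢ b<a)) h)
... | inj₂ (inj₁ (e , z)) = inj₂ (inj₁ (trans (sym (there S b (<⇒≢ b<a))) e ,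
        λ p p<b → trans (sym (there S p (<⇒≢ (<-trans p<b b<a)))) (z p p<b)))
... | inj₂ (inj₂ (_ , e , z)) = ⊥-elim (¬tt (a≡ , fa , fb , λ p a<p →
        trans (sym (there S p (≢-sym (<⇒≢ a<p)))) (z p (<-trans b<a a<p))))
  where
  fa : f a ≡ 1
  fa = step-0-val S (z a b<a)
  fb : f b ≡ 1
  fb = trans (sym (there S b (<⇒≢ b<a))) e
  a≡ : a ≡ suc b
  a≡ with <-cmp a (suc b)
  ... | tri≈ _ q _ = q
  ... | tri< q _ _ = ⊥-elim (1+n≰n (≤-trans q b<a))
  ... | tri> _ q r = ⊥-elim (pos≢0 (con b (suc b) a ≤-refl r (≤-reflexive (sym fb)) (≤-reflexive (sym fa)))
                       (trans (sym (there S (suc b) (≢-sym q))) (z (suc b) ≤-refl)))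

swap-≡ : ∀ {f a g b h g'} → Step f a g → Step g b h → b < a → Step f b g' → ∀ p → p ≢ a → h p ≡ g' p
swap-≡ {a = a} {b = b} S S' b<a T p p≢a with p ≟ b
... | yes refl = suc-injective (trans (sym (here S')) (trans (there S p p≢a) (here T)))
... | no p≢b   = trans (there S' p p≢b) (trans (there S p p≢a) (sym (there T p p≢b)))

swap-at : ∀ {f a g b h g'} → Step f a g → Step g b h → b < a → Step f b g' → g' a ≡ suc (h a)
swap-at {a = a} S S' b<a T =
  trans (there T a (≢-sym (<⇒≢ b<a))) (trans (here S) (cong suc (sym (there S' a (≢-sym (<⇒≢ b<a))))))

-- If the letter at `a` is 1, it is reducible only as the last letter, `b` being to its left. That
-- clause asks for a letter ≥ 2 after the reduction at `b`, which is `nf`.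
swap-nf : ∀ {f a g b h g'} → Step f a g → Step g b h → b < a → Step f b g' → NF g' → Step g' a h
swap-nf {f} {a} {g} {b} {h} {g'} S S' b<a T nf =
  mkStep reducible (swap-at S S' b<a T) (swap-≡ S S' b<a T)
  where
  fb : 1 ≤ f b
  fb = ≤-trans (red-pos (red S')) (step-≤ S b)
  reducible : Red g' a
  reducible with 1 <? f a
  ... | yes q = inj₁ (subst (1 <_) (sym (there T a (≢-sym (<⇒≢ b<a)))) q)
  ... | no q  = inj₂ (inj₂ (nf , trans (there T a (≢-sym (<⇒≢ b<a))) fa ,
        λ p a<p → ≤0 (step-≤ T p) (proj₂ (red-not-first (red S) fa b<a fb) p a<p)))
    where
    fa : f a ≡ 1
    fa = ≤-antisym (≮⇒≥ q) (red-pos (red S))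

swap-nf' : ∀ {f a g b h g'} → Step f a g → Step g b h → b < a → Step f b g' → NF h → NF g'
swap-nf' {a = a} {h = h} {g'} S S' b<a T = nf-mono le
  where
  le : ∀ p → h p ≤ g' p
  le p with p ≟ a
  ... | yes refl = ≤-trans (n≤1+n _) (≤-reflexive (sym (swap-at S S' b<a T)))
  ... | no q     = ≤-reflexive (swap-≡ S S' b<a T p q)

-- If reducing b first gives a flat word, then the letter at a is no longer reducible;
-- removing the first letter instead gives the same word one position further right.
module SwapFlat {f a g b h g' c v} (con : Con f) (S : Step f a g) (S' : Step g b h) (b<a : b < a)
                (T : Step f b g') (flat : ∀ p → g' p ≤ 1) (w : IsWord v) (sh : Sh c h (at v)) where

  private
    fb : 1 ≤ f b
    fb = ≤-trans (red-pos (red S')) (step-≤ S b)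
    ga : g' a ≡ f a
    ga = there T a (≢-sym (<⇒≢ b<a))
    fa : f a ≡ 1
    fa = ≤-antisym (subst (_≤ 1) ga (flat a)) (red-pos (red S))
    last : NF f × (∀ p → a < p → f p ≡ 0)
    last = red-not-first (red S) fa b<a fb
    -- `f` has a letter ≥ 2 and `g'` has none, so it stood at `b`; thus `b` is lowered to 1 and not
    -- removed.
    hb : 1 ≤ h b
    hb with proj₁ last
    ... | (q , f2) with q ≟ b
    ...   | yes refl = subst (1 ≤_) (sym (swap-≡ S S' b<a T b (<⇒≢ b<a)))
                             (s≤s⁻¹ (subst (2 ≤_) (here T) f2))
    ...   | no ne    = ⊥-elim (1+n≰n (≤-trans f2 (subst (_≤ 1) (there T q ne) (flat q))))
    c<b : c < b
    c<b with sh-pos sh hb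
    ... | (q , refl) = subst (c <_) (sym (+-suc c q)) (s≤s (m≤m+n c q))
    vne : ∀ {v} → IsWord v → ∃[ q ] (1 ≤ at v q) → 1 ≤ at v 1
    vne {x ∷ v} (h ∷ _) _ = h
    hc : 1 ≤ h (suc c)
    hc with sh-pos sh hb
    ... | (q , refl) = subst (1 ≤_) (trans (sym (proj₁ sh 1)) (cong h (+-comm c 1)))
                         (vne w (suc q , subst (1 ≤_) (proj₁ sh (suc q)) hb))
    gc : 1 ≤ g' (suc c)
    gc = subst (1 ≤_) (swap-≡ S S' b<a T (suc c) (<⇒≢ (≤-<-trans c<b b<a))) hc
    one : ∀ q → suc c ≤ q → q ≤ a → g' q ≡ 1
    one q c<q q≤a = ≤-antisym (flat q) pos
      where
      pos : 1 ≤ g' q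
      pos with m≤n⇒m<n∨m≡n c<q | m≤n⇒m<n∨m≡n q≤a
      ... | inj₂ refl | _         = gc
      ... | inj₁ _    | inj₂ refl = ≤-reflexive (sym (trans ga fa))
      ... | inj₁ x    | inj₁ y    =
        step-con T con (suc c) q a x y gc (≤-reflexive (sym (trans ga fa)))
    above : ∀ q → a < q → g' q ≡ 0
    above q a<q = ≤0 (step-≤ T q) (proj₂ last q a<q)

  reducible : Red g' (suc c)
  reducible = inj₂ (inj₁ (one (suc c) ≤-refl (≤-trans c<b (<⇒≤ b<a)) , λ p p≤c →
    trans (sym (swap-≡ S S' b<a T p (<⇒≢ (≤-<-trans (s≤s⁻¹ p≤c) (<-trans c<b b<a)))))
          (proj₂ sh p (s≤s⁻¹ p≤c))))

  shifted : ∀ {h'} → Step g' (suc c) h' → Sh (suc c) h' (at v)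
  shifted {h'} U = shift , zeros
    where
    hc0 : h' (suc c) ≡ 0
    hc0 = suc-injective (trans (sym (here U)) (one (suc c) ≤-refl (≤-trans c<b (<⇒≤ b<a))))
    zeros : ∀ p → p ≤ suc c → h' p ≡ 0
    zeros p q with m≤n⇒m<n∨m≡n q
    ... | inj₂ refl  = hc0
    ... | inj₁ p<1+c = ≤0 (step-≤ U p)
      (trans (sym (swap-≡ S S' b<a T p (<⇒≢ (≤-<-trans (s≤s⁻¹ p<1+c) (<-trans c<b b<a)))))
             (proj₂ sh p (s≤s⁻¹ p<1+c)))
    -- From `suc c` on, `g'` is a block of 1s ending at `a`, and `h` is the same block without its
    -- last letter. Dropping the first letter instead slides the block by one.
    next : ∀ q → suc c ≤ q → g' (suc q) ≡ h q
    next q c<q with <-cmp q a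
    ... | tri< q<a ne _ = trans (one (suc q) (≤-trans c<q (n≤1+n q)) q<a)
                         (trans (sym (one q c<q (<⇒≤ q<a))) (sym (swap-≡ S S' b<a T q ne)))
    ... | tri≈ _ refl _ = trans (above (suc q) ≤-refl)
                                (sym (suc-injective (trans (sym (swap-at S S' b<a T)) (trans ga fa))))
    ... | tri> _ ne a<q = trans (above (suc q) (≤-trans a<q (n≤1+n q)))
                         (trans (sym (above q a<q)) (sym (swap-≡ S S' b<a T q ne)))
    shift : ∀ p → h' (suc c + p) ≡ at v p
    shift zero    = trans (cong h' (cong suc (+-identityʳ c))) (trans hc0 (sym (at-0 v)))
    shift (suc p) =
      trans (there U (suc (c + suc p)) (λ e → m+1+n≢m c (suc-injective e)))
     (trans (next (c + suc p) (subst (suc c ≤_) (sym (+-suc c p)) (s≤s (m≤m+n c p))))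
            (proj₁ sh (suc p)))

-- Chains whose descents all remove a trailing 11

module Chain (e : ℕ → Seq) (l : ℕ → ℕ) (n : ℕ)
             (st : ∀ s → s < n → Step (e s) (l s) (e (suc s))) where

  -- No strong descents strictly between the words i and j.
  NSD : ℕ → ℕ → Set
  NSD i j = ∀ s → i ≤ s → suc (suc s) ≤ j → l (suc s) < l s → TT (e s) (l s) (l (suc s))

  NSD-⊆ : ∀ {i j i' j'} → i ≤ i' → j' ≤ j → NSD i j → NSD i' j'
  NSD-⊆ p q h s i'≤s 2+s≤j' = h s (≤-trans p i'≤s) (≤-trans 2+s≤j' q)

  mono : ∀ {s t} → s ≤ t → t ≤ n → ∀ p → e t p ≤ e s p
  mono {s} {zero}  z≤n _ p = ≤-refl
  mono {s} {suc t} s≤t h p with m≤n⇒m<n∨m≡n s≤t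
  ... | inj₂ refl = ≤-refl
  ... | inj₁ s<t  = ≤-trans (step-≤ (st t h) p) (mono (s≤s⁻¹ s<t) (<⇒≤ h) p)

  private
    -- The second alternative describes letters reached by the removals from the right end:
    -- everything from `p` on is gone, while a letter ≥ 2 remains, necessarily left of `p`.
    Untouched : ℕ → ℕ → ℕ → Set
    Untouched m t p = (e t p ≡ e m p) ⊎ (e m p ≡ 1 × (∀ q → p ≤ q → e t q ≡ 0) × NF (e t))

    step-zero : ∀ s → s < n → e s (l s) ≡ 1 → e (suc s) (l s) ≡ 0
    step-zero s s<n q = suc-injective (trans (sym (here (st s s<n))) q)

    -- Such a chain reduces letters from left to right and then removes 1s from the right end.
    invariant : ∀ m t → m ≤ t → suc t ≤ n → NSD m (suc t) →
      (l m ≤ l t ⊎ (∀ q → l t ≤ q → e (suc t) q ≡ 0)) × (∀ p → p < l m → Untouched m (suc t) p)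
    invariant m t m≤t h nsd with m≤n⇒m<n∨m≡n m≤t
    ... | inj₂ refl = inj₁ ≤-refl , λ p p< → inj₁ (there (st t h) p (<⇒≢ p<))
    invariant m (suc t) m≤t h nsd | inj₁ m<t
      with invariant m t (s≤s⁻¹ m<t) (<⇒≤ h) (NSD-⊆ ≤-refl (n≤1+n _) nsd) | l (suc t) <? l t
    ... | (J , K) | no nd = inj₁ lm≤ , keep
      where
      lt≤ : l t ≤ l (suc t)
      lt≤ = ≮⇒≥ nd
      lm≤ : l m ≤ l (suc t)
      -- Once everything from `l t` on is erased, no reduction at or right of `l t` can follow.
      lm≤ = [ (λ x → ≤-trans x lt≤) ,
              (λ z → ⊥-elim (pos≢0 (red-pos (red (st (suc t) h))) (z (l (suc t)) lt≤))) ]′ J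
      keep : ∀ p → p < l m → Untouched m (suc (suc t)) p
      keep p p< with K p p<
      ... | inj₁ q = inj₁ (trans (there (st (suc t) h) p (<⇒≢ (<-≤-trans p< lm≤))) q)
      ... | inj₂ (_ , z , _) =
        ⊥-elim (pos≢0 (red-pos (red (st (suc t) h))) (z (l (suc t)) (≤-trans (<⇒≤ p<) lm≤)))
    ... | (J , K) | yes d = inj₂ zero≥ , keep
      where
      S = st t (<⇒≤ h)
      S' = st (suc t) h
      tt = nsd t (s≤s⁻¹ m<t) ≤-refl d
      e1 : e (suc t) (l (suc t)) ≡ 1
      e1 = trans (there S (l (suc t)) (<⇒≢ d)) (proj₁ (proj₂ (proj₂ tt)))
      zero≥ : ∀ q → l (suc t) ≤ q → e (suc (suc t)) q ≡ 0
      zero≥ q l≤q with m≤n⇒m<n∨m≡n l≤q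
      ... | inj₂ refl = step-zero (suc t) h e1
      ... | inj₁ l<q with m≤n⇒m<n∨m≡n (subst (_≤ q) (sym (proj₁ tt)) l<q)
      ...   | inj₂ refl = ≤0 (step-≤ S' q) (step-zero t (<⇒≤ h) (proj₁ (proj₂ tt)))
      ...   | inj₁ l<'q = ≤0 (step-≤ S' q) (≤0 (step-≤ S q) (proj₂ (proj₂ (proj₂ tt)) q l<'q))
      nf : NF (e (suc (suc t)))
      nf with red-not-first (red S) (proj₁ (proj₂ tt)) d (≤-reflexive (sym (proj₁ (proj₂ (proj₂ tt)))))
      ... | ((q , f2) , _) = q , subst (2 ≤_) (sym (trans (there S' q q≢') (there S q q≢))) f2
        where
        q≢ : q ≢ l t
        q≢ refl = <⇒≢ f2 (sym (proj₁ (proj₂ tt)))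
        q≢' : q ≢ l (suc t)
        q≢' refl = <⇒≢ f2 (sym (proj₁ (proj₂ (proj₂ tt))))
      keep : ∀ p → p < l m → Untouched m (suc (suc t)) p
      keep p p< with K p p<
      ... | inj₂ (x , z , _) = inj₂ (x , (λ q p≤q → ≤0 (step-≤ S' q) (z q p≤q)) , nf)
      ... | inj₁ x with p ≟ l (suc t)
      ...   | no ne    = inj₁ (trans (there S' p ne) x)
      ...   | yes refl = inj₂ (trans (sym x) e1 , zero≥ , nf)

  -- A lost letter at `k` would be a 1 with everything from `k` on erased and a letter ≥ 2
  -- remaining. It was not the last letter, since `l m` is to its right, nor the first, since the
  -- letter ≥ 2 is to its left.
  first-kept : ∀ {m t} → m < t → t ≤ n → NSD m t → ∀ k → k < l m → Red (e m) k → e t k ≡ e m k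
  first-kept {m} {suc t} m<t h nsd k k< r
    with proj₂ (invariant m t (s≤s⁻¹ m<t) h nsd) k k<
  ... | inj₁ x = x
  ... | inj₂ (x , z , (q , f2)) with r
  ...   | inj₁ y = ⊥-elim (<⇒≢ y (sym x))
  ...   | inj₂ (inj₂ (_ , _ , y)) =
    ⊥-elim (pos≢0 (red-pos (red (st m (<-≤-trans m<t h)))) (y (l m) k<))
  ...   | inj₂ (inj₁ (_ , y)) with q <? k
  ...     | yes q<k = ⊥-elim (pos≢0 (≤-trans (<⇒≤ f2) (mono (<⇒≤ m<t) h q)) (y q q<k))
  ...     | no q≮k  = ⊥-elim (pos≢0 (<⇒≤ f2) (z q (≮⇒≥ q≮k)))

  vanishing : ∀ m t → m ≤ t → t ≤ n → ∀ p → 1 ≤ e m p → e t p ≡ 0 →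
    ∃[ s ] (m ≤ s × s < t × 1 ≤ e s p × e (suc s) p ≡ 0)
  vanishing m zero    z≤n h p pos z = ⊥-elim (pos≢0 pos z)
  vanishing m (suc t) m≤t h p pos z with m≤n⇒m<n∨m≡n m≤t
  ... | inj₂ refl = ⊥-elim (pos≢0 pos z)
  ... | inj₁ m<t with 1 ≤? e t p
  ...   | yes q = t , s≤s⁻¹ m<t , ≤-refl , q , z
  ...   | no q with vanishing m t (s≤s⁻¹ m<t) (<⇒≤ h) p pos (≯0⇒0 q)
  ...     | (s , a , b , c , d) = s , a , ≤-trans b (n≤1+n t) , c , d

  -- When `suc p` is emptied, `p` is still positive, so `suc p` was the last letter and nothing to
  -- its right can be reduced later. One more step would be a descent, which has to remove a
  -- trailing 11 and with it `p`.
  last-step : ∀ {m t} → m < suc t → suc t ≤ n → NSD m (suc t) → ∀ p →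
    e (suc t) (suc p) ≡ 0 → 1 ≤ e m (suc p) → 1 ≤ e (suc t) p →
    l t ≡ suc p × e t (suc p) ≡ 1 × (∀ q → suc p < q → e t q ≡ 0) × NF (e (suc t))
  last-step {m} {t} m<t h nsd p z pos posp
    with vanishing m (suc t) (<⇒≤ m<t) h (suc p) pos z
  ... | (s , m≤s , s<t , es , zs) = result (m≤n⇒m<n∨m≡n s<t)
    where
    s<n = <-≤-trans s<t h
    S = st s s<n
    ls : suc p ≡ l s
    ls = step-0 S (suc p) es zs
    e1 : e s (l s) ≡ 1
    e1 = step-0-val S (subst (λ x → e (suc s) x ≡ 0) ls zs)
    last : NF (e s) × (∀ q → l s < q → e s q ≡ 0)
    last = red-not-first (red S) e1 (subst (p <_) ls ≤-refl)
             (≤-trans posp (mono (<⇒≤ s<t) h p))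
    result : suc s < suc t ⊎ suc s ≡ suc t →
      l t ≡ suc p × e t (suc p) ≡ 1 × (∀ q → suc p < q → e t q ≡ 0) × NF (e (suc t))
    result (inj₂ refl) = sym ls , trans (cong (e t) ls) e1 ,
      (λ q lt → proj₂ last q (subst (_< q) ls lt)) , nf (proj₁ last)
      where
      nf : NF (e t) → NF (e (suc t))
      nf (q , f2) = q , subst (2 ≤_) (sym (there S q (λ { refl → <⇒≢ f2 (sym e1) }))) f2
    result (inj₁ s<t') = ⊥-elim (pos≢0 posp (≤0 (mono s<t' h p) gone))
      where
      s'<n = <-≤-trans s<t' h
      S' = st (suc s) s'<n
      d : l (suc s) < l s
      d with l (suc s) <? l s
      ... | yes q = q
      ... | no q with m≤n⇒m<n∨m≡n (≮⇒≥ q)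
      ...   | inj₂ x = ⊥-elim (pos≢0 (red-pos (red S')) (subst (λ x → e (suc s) x ≡ 0) (trans ls x) zs))
      ...   | inj₁ x = ⊥-elim (pos≢0 (red-pos (red S')) (≤0 (step-≤ S _) (proj₂ last _ x)))
      tt = nsd s m≤s s<t' d
      p≡ : l (suc s) ≡ p
      p≡ = suc-injective (trans (sym (proj₁ tt)) (sym ls))
      gone : e (suc (suc s)) p ≡ 0
      gone = subst (λ x → e (suc (suc s)) x ≡ 0) p≡
        (step-zero (suc s) s'<n (trans (there S _ (<⇒≢ d)) (proj₁ (proj₂ (proj₂ tt)))))

-- Embeddings as lists

emb-sh : ∀ a v b → Sh a (at (replicate a 0 ++ v ++ replicate b 0)) (at v)
emb-sh zero    v b = at-++-zeros v b , λ { zero z≤n → at-0 (v ++ replicate b 0) }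
emb-sh (suc a) v b = (λ p → trans (at-0∷ rest (a + p)) (proj₁ ih p)) , zeros
  where
  rest = replicate a 0 ++ v ++ replicate b 0
  ih = emb-sh a v b
  zeros : ∀ p → p ≤ suc a → at (0 ∷ rest) p ≡ 0
  zeros zero    _       = refl
  zeros (suc p) (s≤s h) = trans (at-0∷ rest p) (proj₂ ih p h)

all0-replicate : ∀ η → (∀ p → at η p ≡ 0) → η ≡ replicate (length η) 0
all0-replicate []      z = refl
all0-replicate (x ∷ η) z = cong₂ _∷_ (z 1) (all0-replicate η tail0)
  where
  tail0 : ∀ p → at η p ≡ 0
  tail0 zero    = at-0 η
  tail0 (suc p) = z (suc (suc p))

prefix-emb : ∀ {v} η → IsWord v → (∀ p → at η p ≡ at v p) → ∃[ b ] (η ≡ v ++ replicate b 0)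
prefix-emb {[]}    η       w       h = length η , all0-replicate η h
prefix-emb {x ∷ v} []      (k ∷ w) h = ⊥-elim (pos≢0 k (sym (h 1)))
prefix-emb {x ∷ v} (y ∷ η) (k ∷ w) h with prefix-emb {v} η w tails
  where
  tails : ∀ p → at η p ≡ at v p
  tails zero    = trans (at-0 η) (sym (at-0 v))
  tails (suc p) = h (suc (suc p))
... | (b , q) = b , cong₂ _∷_ (h 1) q

sh-emb : ∀ {v} a η → IsWord v → Sh a (at η) (at v) → EmbOf η v
sh-emb zero η w (s , _) with prefix-emb η w s
... | (b , q) = 0 , b , q
sh-emb (suc a) [] w (s , z) with all0-word w (λ p → sym (s p))
... | refl = 0 , 0 , refl
sh-emb {v} (suc a) (x ∷ η) w (s , z) with z 1 (s≤s z≤n)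
... | refl with sh-emb a η w ((λ p → trans (sym (at-0∷ η (a + p))) (s p)) ,
                              (λ p h → trans (sym (at-0∷ η p)) (z (suc p) (s≤s h))))
...   | (a' , b , q) = suc a' , b , cong (0 ∷_) q

emb-rep : ∀ {η v} → IsWord v → EmbOf η v → Rep (at η) v
emb-rep {v = v} w (a , b , refl) = w , a , emb-sh a v b

rep-emb : ∀ {v} η → Rep (at η) v → EmbOf η v
rep-emb η (w , a , s) = sh-emb a η w s

rep-con : ∀ {f v} → Rep f v → Con f
rep-con {f} {v} (w , a , s) p q r p<q q<r fp fr with sh-pos s fp | sh-pos s fr
... | (p' , refl) | (r' , refl) with split a q
...   | inj₁ q≤a = ⊥-elim (1+n≰n (≤-trans (≤-trans (s≤s (m≤m+n a (suc p'))) p<q) q≤a))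
...   | inj₂ (q' , refl) = subst (1 ≤_) (sym (proj₁ s (suc q')))
        (word-at w (suc q') (s≤s z≤n)
          (≤-trans (<⇒≤ (+-cancelˡ-< a _ _ q<r)) (at-pos⇒≤ v (suc r') (subst (1 ≤_) (proj₁ s (suc r')) fr))))

con-tail : ∀ {x η} → Con (at (x ∷ η)) → Con (at η)
con-tail {x} {η} c zero    q       r       p<q q<r hp hr = ⊥-elim (pos≢0 hp (at-0 η))
con-tail {x} {η} c (suc p) (suc q) (suc r) p<q q<r hp hr =
  c (suc (suc p)) (suc (suc q)) (suc (suc r)) (s≤s p<q) (s≤s q<r) hp hr

con-word : ∀ η → Con (at η) → ∃[ v ] (IsWord v × EmbOf η v)
con-word [] c = [] , [] , 0 , 0 , refl
con-word (zero ∷ η) c with con-word η (con-tail c)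
... | (v , w , a , b , q) = v , w , suc a , b , cong (0 ∷_) q
con-word (suc x ∷ η) c with body x η c
  where
  body : ∀ x η → Con (at (suc x ∷ η)) → ∃[ v ] (IsWord v × ∃[ b ] (η ≡ v ++ replicate b 0))
  body x [] c = [] , [] , 0 , refl
  body x (suc y ∷ η) c with body y η (con-tail c)
  ... | (v , w , b , q) = suc y ∷ v , s≤s z≤n ∷ w , b , cong (suc y ∷_) q
  body x (zero ∷ η) c = [] , [] , suc (length η) , cong (0 ∷_) (all0-replicate η zeros)
    where
    zeros : ∀ p → at η p ≡ 0
    zeros zero = at-0 η
    zeros (suc p) with 1 ≤? at η (suc p)
    ... | no h  = ≯0⇒0 h
    ... | yes h with c 1 2 (suc (suc (suc p))) ≤-refl (s≤s (s≤s (s≤s z≤n))) (s≤s z≤n) h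
    ...   | ()
... | (v , w , b , q) = suc x ∷ v , s≤s z≤n ∷ w , 0 , b , cong (suc x ∷_) q

word-reverse : ∀ {v} → IsWord v → IsWord (reverse v)
word-reverse {[]}    [] = []
word-reverse {x ∷ v} (h ∷ w) = subst IsWord (sym (unfold-reverse x v)) (++⁺ (word-reverse w) (h ∷ []))

dropZ-zeros : ∀ a xs → dropZ (replicate a 0 ++ xs) ≡ dropZ xs
dropZ-zeros zero    xs = refl
dropZ-zeros (suc a) xs = dropZ-zeros a xs

dropZ-word : ∀ {v} → IsWord v → dropZ v ≡ v
dropZ-word []              = refl
dropZ-word (s≤s z≤n ∷ w) = refl

reverse-zeros : ∀ b → reverse (replicate b 0) ≡ replicate b 0
reverse-zeros b = trans (all0-replicate _ (zeros b)) (cong (λ x → replicate x 0) len)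
  where
  len : length (reverse (replicate b 0)) ≡ b
  len = trans (length-reverse (replicate b 0)) (length-replicate b)
  at-all0 : ∀ {xs} → All (_≡ 0) xs → ∀ p → at xs p ≡ 0
  at-all0 []      p             = refl
  at-all0 (h ∷ z) zero          = refl
  at-all0 (h ∷ z) (suc zero)    = h
  at-all0 (h ∷ z) (suc (suc p)) = at-all0 z (suc p)
  all0 : ∀ b → All (_≡ 0) (reverse (replicate b 0))
  all0 zero    = []
  all0 (suc b) = subst (All (_≡ 0)) (sym (unfold-reverse 0 (replicate b 0))) (++⁺ (all0 b) (refl ∷ []))
  zeros : ∀ b p → at (reverse (replicate b 0)) p ≡ 0
  zeros b = at-all0 (all0 b)

stripZ-emb : ∀ {η v} → IsWord v → EmbOf η v → stripZ η ≡ v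
stripZ-emb {v = v} w (a , b , refl) =
  trans (cong (λ x → reverse (dropZ (reverse x))) (dropZ-zeros a (v ++ replicate b 0))) (strip v w)
  where
  strip : ∀ v → IsWord v → reverse (dropZ (reverse (dropZ (v ++ replicate b 0)))) ≡ v
  strip [] _ = cong (λ x → reverse (dropZ (reverse x)))
    (trans (cong dropZ (sym (++-identityʳ (replicate b 0)))) (dropZ-zeros b []))
  strip v@(suc x ∷ v') w =
    trans (cong (λ y → reverse (dropZ y)) (trans (reverse-++ v (replicate b 0)) (cong (_++ reverse v) (reverse-zeros b))))
   (trans (cong reverse (trans (dropZ-zeros b (reverse v)) (dropZ-word (word-reverse w))))
          (reverse-involutive v))
  strip (zero ∷ v') (() ∷ _)

rep-strip : ∀ {v} η → Rep (at η) v → stripZ η ≡ v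
rep-strip η r = stripZ-emb (proj₁ r) (rep-emb η r)

strip-rep : ∀ η → Con (at η) → Rep (at η) (stripZ η)
strip-rep η c with con-word η c
... | (v , w , em) = subst (Rep (at η)) (sym (stripZ-emb w em)) (emb-rep w em)

sum-zeros : ∀ a → sum (replicate a 0) ≡ 0
sum-zeros zero    = refl
sum-zeros (suc a) = sum-zeros a

sum-emb : ∀ {η v} → EmbOf η v → sum η ≡ sum v
sum-emb {v = v} (a , b , refl) =
  trans (sum-++ (replicate a 0) _) (trans (cong₂ _+_ (sum-zeros a) (sum-++ v _))
    (trans (cong (sum v +_) (sum-zeros b)) (+-identityʳ _)))

lz-emb : ∀ {v} a xs → 1 ≤ at v 1 → lz (replicate a 0 ++ v ++ xs) ≡ a
lz-emb {suc x ∷ v} zero    xs h = refl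
lz-emb             (suc a) xs h = cong suc (lz-emb a xs h)

flat⇒≤1 : ∀ {v} → Flat v → ∀ p → at v p ≤ 1
flat⇒≤1 []         p             = z≤n
flat⇒≤1 (h ∷ f)    zero          = z≤n
flat⇒≤1 (refl ∷ f) (suc zero)    = ≤-refl
flat⇒≤1 (h ∷ f)    (suc (suc p)) = flat⇒≤1 f (suc p)

nf⇒¬flat : ∀ {v} → NF (at v) → ¬ Flat v
nf⇒¬flat (p , h) f = 1+n≰n (≤-trans h (flat⇒≤1 f p))

nf? : ∀ xs → NF (at xs) ⊎ (∀ p → at xs p ≤ 1)
nf? [] = inj₂ λ p → z≤n
nf? (x ∷ xs) with 2 ≤? x | nf? xs
... | yes h | _ = inj₁ (1 , h)
... | no h  | inj₁ (suc p , q) = inj₁ (suc (suc p) , q)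
... | no h  | inj₁ (zero , q) = ⊥-elim (pos≢0 (<⇒≤ q) (at-0 xs))
... | no h  | inj₂ q = inj₂ le
  where
  le : ∀ p → at (x ∷ xs) p ≤ 1
  le zero          = z≤n
  le (suc zero)    = s≤s⁻¹ (≰⇒> h)
  le (suc (suc p)) = q (suc p)

¬flat⇒nf : ∀ {v} → IsWord v → ¬ Flat v → NF (at v)
¬flat⇒nf {v} w h with nf? v
... | inj₁ nf = nf
... | inj₂ le = ⊥-elim (h (flat w le))
  where
  flat : ∀ {v} → IsWord v → (∀ p → at v p ≤ 1) → Flat v
  flat []                  le = []
  flat {x ∷ v} (h ∷ w) le = ≤-antisym (le 1) h ∷ flat w tails
    where
    tails : ∀ p → at v p ≤ 1
    tails zero    = subst (_≤ 1) (sym (at-0 v)) z≤n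
    tails (suc p) = le (suc (suc p))

redEmb⇒red : ∀ η {v k} → Rep (at η) v → RedEmb η v k → Red (at η) k
redEmb⇒red η r (_ , _ , inj₁ h) = inj₁ h
redEmb⇒red η r (_ , _ , inj₂ (inj₁ (h , z))) = inj₂ (inj₁ (h , λ { zero _ → at-0 η ; (suc p) q → z (suc p) (s≤s z≤n) q }))
redEmb⇒red η (w , _ , s) (_ , _ , inj₂ (inj₂ (nf , h , z))) = inj₂ (inj₂ (sh-nf s (¬flat⇒nf w nf) , h , z))

red⇒redEmb : ∀ η {v k} → Rep (at η) v → Red (at η) k → RedEmb η v k
red⇒redEmb η {v} {k} (w , _ , s) r = at-pos⇒1≤ η k (red-pos r) , at-pos⇒≤ η k (red-pos r) , cases r
  where
  cases : Red (at η) k → _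
  cases (inj₁ h)                  = inj₁ h
  cases (inj₂ (inj₁ (h , z)))     = inj₂ (inj₁ (h , λ p _ → z p))
  cases (inj₂ (inj₂ (nf , h , z))) = inj₂ (inj₂ (nf⇒¬flat (sh-nf↓ s nf) , h , z))

redWord⇒red : ∀ {w k} → IsWord w → RedWord w k → Red (at w) k
redWord⇒red i (_ , _ , inj₁ h) = inj₁ h
redWord⇒red {w} i (_ , _ , inj₂ (inj₁ (h , refl))) = inj₂ (inj₁ (h , λ { zero _ → at-0 w ; (suc p) (s≤s ()) }))
redWord⇒red {w} i (_ , _ , inj₂ (inj₂ (h , refl , nf))) = inj₂ (inj₂ (¬flat⇒nf i nf , h , at-> w))

red⇒redWord : ∀ {w k} → IsWord w → Red (at w) k → RedWord w k
red⇒redWord {w} {k} i r = 1≤k , k≤ , cases r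
  where
  1≤k = at-pos⇒1≤ w k (red-pos r)
  k≤ = at-pos⇒≤ w k (red-pos r)
  cases : Red (at w) k → _
  cases (inj₁ h) = inj₁ h
  cases (inj₂ (inj₁ (h , z))) = inj₂ (inj₁ (h , k≡))
    where
    k≡ : k ≡ 1
    k≡ with m≤n⇒m<n∨m≡n 1≤k
    ... | inj₂ e = sym e
    ... | inj₁ q = ⊥-elim (pos≢0 (word-at i 1 ≤-refl (≤-trans 1≤k k≤)) (z 1 q))
  cases (inj₂ (inj₂ (nf , h , z))) = inj₂ (inj₂ (h , k≡ , nf⇒¬flat nf))
    where
    k≡ : k ≡ length w
    k≡ with m≤n⇒m<n∨m≡n k≤
    ... | inj₂ e = e
    ... | inj₁ q = ⊥-elim (pos≢0 (word-at i (length w) (≤-trans 1≤k k≤) ≤-refl) (z (length w) q))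

-- Generalized factor order

sh-length-≤ : ∀ {a f b g} x y → (∀ p → g p ≤ f p) → Sh a f (at x) → IsWord y → Sh (a + b) g (at y) →
              1 ≤ length y → b + length y ≤ length x
sh-length-≤ {a} {f} {b} {g} x y le (s , _) wy (s' , _) ne =
  at-pos⇒≤ x (b + length y) (≤-trans (word-at wy (length y) ne ≤-refl)
    (≤-trans (≤-reflexive (sym (s' (length y)))) (≤-trans (le _)
      (≤-reflexive (trans (cong f (+-assoc a b (length y))) (s _))))))

sh-at-≤ : ∀ {a f b g} x y → (∀ p → g p ≤ f p) → Sh a f (at x) → Sh (a + b) g (at y) →
          ∀ q → at y q ≤ at x (b + q)
sh-at-≤ {a} {f} {b} x y le (s , _) (s' , _) q =
  ≤-trans (≤-reflexive (sym (s' q))) (≤-trans (le _) (≤-reflexive (trans (cong f (+-assoc a b q)) (s _))))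

rep-≼ : ∀ {f g x y} → (∀ p → g p ≤ f p) → Rep f x → Rep g y → y ≼ x
rep-≼ {y = []}    le _           _ = 0 , z≤n , λ { zero () _ ; (suc j) _ () }
rep-≼ {f} {g} {x} {y@(_ ∷ _)} le (wx , a , s) (wy@(h ∷ _) , b , s') with split a (suc b)
... | inj₁ b<a = ⊥-elim (pos≢0 h (trans (sym (proj₁ s' 1)) (≤0 (le _) (proj₂ s _ (subst (_≤ a) (+-comm 1 b) b<a)))))
... | inj₂ (c , e) with suc-injective (trans e (+-suc a c))
...   | refl = c , sh-length-≤ x y le s wy s' (s≤s z≤n) , λ j _ _ → sh-at-≤ x y le s s' j

sum-≼ : ∀ {y z} → IsWord z → y ≼ z → sum y ≤ sum z × (sum y ≡ sum z → y ≡ z)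
sum-≼ {y} {z} wz (i , len , le) = go i y z wz len le
  where
  go : ∀ i y z → IsWord z → i + length y ≤ length z →
       (∀ j → 1 ≤ j → j ≤ length y → at y j ≤ at z (i + j)) → sum y ≤ sum z × (sum y ≡ sum z → y ≡ z)
  go zero [] []      w len le = z≤n , λ _ → refl
  go zero [] (x ∷ z) (h ∷ w) len le = z≤n , λ e → ⊥-elim (pos≢0 (≤-trans h (m≤m+n x (sum z))) (sym e))
  go zero (y ∷ ys) (z ∷ zs) (h ∷ w) (s≤s len) le = +-mono-≤ yz (proj₁ ih) , eq
    where
    yz : y ≤ z
    yz = le 1 ≤-refl (s≤s z≤n)
    ih = go zero ys zs w len (λ { (suc j) _ q → le (suc (suc j)) (s≤s z≤n) (s≤s q) })
    eq : y + sum ys ≡ z + sum zs → y ∷ ys ≡ z ∷ zs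
    eq e with m≤n⇒m<n∨m≡n yz
    ... | inj₁ y<z = ⊥-elim (<⇒≢ (+-mono-<-≤ y<z (proj₁ ih)) e)
    ... | inj₂ refl = cong (y ∷_) (proj₂ ih (+-cancelˡ-≡ y _ _ e))
  go (suc i) y (z ∷ zs) (h ∷ w) (s≤s len) le = ≤-trans (proj₁ ih) (m≤n+m (sum zs) z) ,
    λ e → ⊥-elim (<⇒≢ (≤-trans (s≤s (proj₁ ih)) (+-monoˡ-≤ (sum zs) h)) e)
    where
    ih = go i y zs w len (λ j 1≤j q → subst (at y j ≤_) (nz j 1≤j) (le j 1≤j q))
      where
      nz : ∀ j → 1 ≤ j → at (z ∷ zs) (suc i + j) ≡ at zs (i + j)
      nz (suc j) _ = subst (λ x → at (z ∷ zs) (suc x) ≡ at zs x) (sym (+-suc i j)) refl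

-- The letter sum is strictly monotone in the factor order, so a word strictly between would have a
-- sum strictly between two consecutive numbers.
covers : ∀ {x y} → IsWord x → y ≼ x → suc (sum y) ≡ sum x → Covers x y
covers {x} {y} wx le e = le , (λ { refl → 1+n≢n e }) , between
  where
  between : ∀ z → IsWord z → y ≼ z → z ≼ x → (z ≡ y) ⊎ (z ≡ x)
  between z wz y≼z z≼x with sum-≼ wz y≼z | sum-≼ wx z≼x
  ... | (a , eqa) | (b , eqb) with m≤n⇒m<n∨m≡n b
  ...   | inj₂ q = inj₂ (eqb q)
  ...   | inj₁ q = inj₁ (sym (eqa (≤-antisym a (s≤s⁻¹ (subst (suc (sum z) ≤_) (sym e) q)))))

-- Sequences of reductions

data Path : List ℕ → List ℕ → List ℕ → Set where
  done : ∀ {η} → Path η [] η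
  _∷_  : ∀ {η k ks ζ} → Red (at η) k → Path (decAt η k) ks ζ → Path η (k ∷ ks) ζ

-- Records words and not embeddings: a skipped interval only asks that the earlier chain pass
-- through the same words, possibly at other offsets.
data Through : List ℕ → List ℕ → Word → Set where
  now  : ∀ {η ks x} → Rep (at η) x → Through η ks x
  later : ∀ {η k ks x} → Through (decAt η k) ks x → Through η (k ∷ ks) x

path-++ : ∀ {η ks ζ ls θ} → Path η ks ζ → Path ζ ls θ → Path η (ks ++ ls) θ
path-++ done    q = q
path-++ (r ∷ p) q = r ∷ path-++ p q

through-++ˡ : ∀ {η ks x} ls → Through η ks x → Through η (ks ++ ls) x
through-++ˡ ls (now r)  = now r
through-++ˡ ls (later t) = later (through-++ˡ ls t)

through-++ʳ : ∀ {η ks ζ ls x} → Path η ks ζ → Through ζ ls x → Through η (ks ++ ls) x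
through-++ʳ done    t = t
through-++ʳ (r ∷ p) t = later (through-++ʳ p t)

path-≤ : ∀ {η ks ζ} → Path η ks ζ → ∀ p → at ζ p ≤ at η p
path-≤ done p = ≤-refl
path-≤ {η} (r ∷ q) p = ≤-trans (path-≤ q p) (step-≤ (step-decAt η r) p)

path-length : ∀ {η ks ζ} → Path η ks ζ → length ζ ≡ length η
path-length done = refl
path-length {η} {k ∷ _} (r ∷ p) = trans (path-length p) (length-decAt η k)

path-sum : ∀ {η ks ζ} → Path η ks ζ → sum η ≡ length ks + sum ζ
path-sum done = refl
path-sum {η} {k ∷ _} (r ∷ p) = trans (sym (sum-decAt η k (red-pos r))) (cong suc (path-sum p))

-- Brings reductions of an embedding back to the word itself, to compare them with chains of a
-- subinterval, whose ids are counted from the start of their own top word.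
path-↓ : ∀ {a η ks η'} ζ → Sh a (at η) (at ζ) → Path η ks η' →
         ∃[ ks' ] ∃[ ζ' ] (ks ≡ map (a +_) ks' × Path ζ ks' ζ' × Sh a (at η') (at ζ'))
path-↓ ζ s done = [] , ζ , refl , done , s
path-↓ {a} {η} {k ∷ _} ζ s (r ∷ p) with sh-pos s (red-pos r)
... | (q , refl) with path-↓ (decAt ζ (suc q)) (sh-step s (step-decAt η r) (step-decAt ζ (sh-red↓ s r))) p
...   | (ks' , ζ' , e , p' , s') = suc q ∷ ks' , ζ' , cong (a + suc q ∷_) e , sh-red↓ s r ∷ p' , s'

sh-rep : ∀ {a b f g h v} → Sh a f h → Sh b g h → Rep f v → Rep g v
sh-rep {a} {b} {f} {g} {h} {[]} (s , z) (s' , z') (w , c , t) =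
  w , b , (λ p → trans (s' p) (trans (sym (s p)) (sh-all0 t (a + p)))) , z'
sh-rep {a} {b} {f} {g} {h} {v@(_ ∷ _)} s s' (w@(v1 ∷ _) , c , t) with m≤n⇒∃[o]m+o≡n (sh-offset t s v1)
... | (d , refl) = w , b + d , sh-trans s' ((λ p → trans (sym (proj₁ s (d + p))) (trans (cong f (sym (+-assoc a d p))) (proj₁ t p))) ,
        λ p p≤d → trans (sym (proj₁ s p)) (proj₂ t (a + p) (+-monoʳ-≤ a p≤d)))

-- Reductions of one embedding can be replayed at any other embedding of the same word; the ids may
-- change, the words passed do not. This continues a detour along the given chain.
transport : ∀ {a b η ζ ks η'} h → Sh a (at η) (at h) → Sh b (at ζ) (at h) → Path η ks η' →
  ∃[ ks' ] ∃[ ζ' ] (Path ζ ks' ζ' × (∀ x → Through η ks x → Through ζ ks' x) × (∀ x → Rep (at η') x → Rep (at ζ') x))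
transport {ζ = ζ} h s s' done = [] , ζ , done , (λ { x (now r) → now (sh-rep s s' r) }) , λ x r → sh-rep s s' r
transport {a} {b} {η} {ζ} {k ∷ ks} h s s' (r ∷ p) with sh-pos s (red-pos r)
... | (q , refl) with transport (decAt h (suc q)) (sh-step s (step-decAt η r) (step-decAt h (sh-red↓ s r)))
                        (sh-step s' (step-decAt ζ (sh-red↑ s' (sh-red↓ s r))) (step-decAt h (sh-red↓ s r))) p
...   | (ks' , ζ' , p' , th , re) = b + suc q ∷ ks' , ζ' , sh-red↑ s' (sh-red↓ s r) ∷ p' ,
        (λ { x (now t) → now (sh-rep s s' t) ; x (later t) → later (th x t) }) , re

least : ∀ {P : ℕ → Set} → (∀ k → Dec (P k)) → ∀ N →
        (∃[ k ] (P k × (∀ p → p < k → ¬ P p))) ⊎ (∀ k → k < N → ¬ P k)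
least P? zero = inj₂ λ k ()
least P? (suc N) with least P? N
... | inj₁ r = inj₁ r
... | inj₂ none with P? N
...   | yes p = inj₁ (N , p , none)
...   | no ¬p = inj₂ λ k k≤N → [ none k , (λ { refl → ¬p }) ]′ (m≤n⇒m<n∨m≡n (s≤s⁻¹ k≤N))

greatest : ∀ {P : ℕ → Set} → (∀ k → Dec (P k)) → ∀ N →
           (∃[ k ] (P k × (∀ p → k < p → p < N → ¬ P p))) ⊎ (∀ k → k < N → ¬ P k)
greatest P? zero = inj₂ λ k ()
greatest P? (suc N) with P? N
... | yes p = inj₁ (N , p , λ q N<q q≤N → ⊥-elim (1+n≰n (≤-trans N<q (s≤s⁻¹ q≤N))))
... | no ¬p with greatest P? N
...   | inj₁ (k , pk , none) = inj₁ (k , pk , λ q k<q q≤N → [ none q k<q , (λ { refl → ¬p }) ]′ (m≤n⇒m<n∨m≡n (s≤s⁻¹ q≤N)))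
...   | inj₂ none = inj₂ λ k k≤N → [ none k , (λ { refl → ¬p }) ]′ (m≤n⇒m<n∨m≡n (s≤s⁻¹ k≤N))

-- Letters left of a letter ≥ 2 of the target are reduced from the left, the others from the right.
module _ {f g : Seq} (con : Con g) (c : ℕ) (c2 : 2 ≤ g c) (le : ∀ p → g p ≤ f p) where

  red-least : ∀ k → g k < f k → (∀ p → p < k → ¬ (g p < f p)) → k < c → Red f k
  red-least k lt none k<c with 1 <? f k
  ... | yes h = inj₁ h
  ... | no h  = inj₂ (inj₁ (f1 , first))
    where
    f1 : f k ≡ 1
    f1 = ≤-antisym (≮⇒≥ h) (≤-trans (s≤s z≤n) lt)
    first : ∀ p → p < k → f p ≡ 0
    first p p<k with 1 ≤? f p
    ... | no q  = ≯0⇒0 q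
    ... | yes q = ⊥-elim (1+n≰n (≤-trans (s≤s (con p k c p<k k<c (≤-trans q (≮⇒≥ (none p p<k))) (<⇒≤ c2))) (subst (g k <_) f1 lt)))

  red-greatest : ∀ k → g k < f k → (∀ p → k < p → ¬ (g p < f p)) → c ≤ k → Red f k
  red-greatest k lt none c≤k with 1 <? f k
  ... | yes h = inj₁ h
  ... | no h  = inj₂ (inj₂ ((c , ≤-trans c2 (le c)) , f1 , last))
    where
    f1 : f k ≡ 1
    f1 = ≤-antisym (≮⇒≥ h) (≤-trans (s≤s z≤n) lt)
    gk : g k ≡ 0
    gk = n<1⇒n≡0 (subst (g k <_) f1 lt)
    c<k : c < k
    c<k = ≤∧≢⇒< c≤k λ { refl → pos≢0 (<⇒≤ c2) gk }
    last : ∀ p → k < p → f p ≡ 0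
    last p k<p with 1 ≤? f p
    ... | no q  = ≯0⇒0 q
    ... | yes q = ⊥-elim (pos≢0 (con c k p c<k k<p (<⇒≤ c2) (≤-trans q (≮⇒≥ (none p k<p)))) gk)

  reducible-exists : ∀ N → (∀ p → N ≤ p → f p ≡ 0) → (∃[ k ] (g k < f k × Red f k)) ⊎ (∀ p → g p ≡ f p)
  reducible-exists N beyond with least (λ k → g k <? f k) N
  ... | inj₂ none = inj₂ λ p → ≤-antisym (le p) (≮⇒≥ (ge p))
    where
    ge : ∀ p → ¬ (g p < f p)
    ge p h with p <? N
    ... | yes q = none p q h
    ... | no q  = pos≢0 (≤-trans (s≤s z≤n) h) (beyond p (≮⇒≥ q))
  ... | inj₁ (k , lt , none) with k <? c
  ...   | yes k<c = inj₁ (k , lt , red-least k lt none k<c)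
  ...   | no k≮c with greatest (λ k → g k <? f k) N
  ...     | inj₂ none' = ⊥-elim (none' k (≰⇒> λ q → pos≢0 (≤-trans (s≤s z≤n) lt) (beyond k q)) lt)
  ...     | inj₁ (K , lt' , none') = inj₁ (K , lt' , red-greatest K lt' none'' (≤-trans (≮⇒≥ k≮c) (≮⇒≥ λ q → none K q lt')))
    where
    none'' : ∀ p → K < p → ¬ (g p < f p)
    none'' p K<p h with p <? N
    ... | yes q = none' p K<p q h
    ... | no q  = pos≢0 (≤-trans (s≤s z≤n) h) (beyond p (≮⇒≥ q))

dec-≤ : ∀ η {k} {g : Seq} → Red (at η) k → g k < at η k → (∀ p → g p ≤ at η p) → ∀ p → g p ≤ at (decAt η k) p
dec-≤ η {k} {g} r lt le p with p ≟ k
... | yes refl = s≤s⁻¹ (subst (g p <_) (here (step-decAt η r)) lt)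
... | no ne    = subst (g p ≤_) (sym (there (step-decAt η r) p ne)) (le p)

-- Reducing a letter above `ζ` lowers the sum and stays above `ζ`, so the process ends at `ζ` unless
-- it gets stuck. For a flat target it may, as from 11 to 10.
path-exists : ∀ ζ → Con (at ζ) → NF (at ζ) → ∀ η → length ζ ≡ length η → (∀ p → at ζ p ≤ at η p) →
              ∃[ ks ] Path η ks ζ
path-exists ζ con (c , c2) η len le = go (sum η) η refl len le
  where
  go : ∀ d η → sum η ≡ d → length ζ ≡ length η → (∀ p → at ζ p ≤ at η p) → ∃[ ks ] Path η ks ζ
  go d η e len le with reducible-exists con c c2 le (suc (length η)) (at-> η)
  ... | inj₂ same with at-ext ζ η len same
  ...   | refl = [] , done
  go zero η e len le | inj₁ (k , lt , r) = ⊥-elim (1+n≢0 (trans (sum-decAt η k (red-pos r)) e))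
  go (suc d) η e len le | inj₁ (k , lt , r)
    with go d (decAt η k) (suc-injective (trans (sum-decAt η k (red-pos r)) e))
            (trans len (sym (length-decAt η k))) (dec-≤ η r lt le)
  ... | (ks , p) = k ∷ ks , r ∷ p

-- The maximal chain given by a sequence of reductions

runs : List ℕ → List ℕ → List ℕ
runs η []       = η
runs η (k ∷ ks) = runs (decAt η k) ks

path-runs : ∀ {η ks ζ} → Path η ks ζ → runs η ks ≡ ζ
path-runs done    = refl
path-runs (r ∷ p) = path-runs p

state : List ℕ → List ℕ → ℕ → List ℕ
state η ks k = runs η (take k ks)

path-steps : ∀ {η ks ζ} → Path η ks ζ → ∀ k → k < length ks →
  Red (at (state η ks k)) (at ks (suc k)) × state η ks (suc k) ≡ decAt (state η ks k) (at ks (suc k))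
path-steps (r ∷ p) zero    h       = r , refl
path-steps (r ∷ p) (suc k) (s≤s h) = path-steps p k h

state-con : ∀ {η ks ζ} → Path η ks ζ → Con (at η) → ∀ k → Con (at (state η ks k))
state-con p       c zero    = c
state-con done    c (suc k) = c
state-con {η} (r ∷ p) c (suc k) = state-con p (step-con (step-decAt η r) c) k

state-last : ∀ η ks → state η ks (length ks) ≡ runs η ks
state-last η []       = refl
state-last η (k ∷ ks) = state-last (decAt η k) ks

through-state : ∀ {η ks x} → Through η ks x → ∃[ k ] (k ≤ length ks × Rep (at (state η ks k)) x)
through-state (now r) = 0 , z≤n , r
through-state (later t) with through-state t
... | (k , h , r) = suc k , s≤s h , r

word-con : ∀ {w} → IsWord w → Con (at w)
word-con {w} i = rep-con (i , 0 , sh-0 w)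

word-strip : ∀ {w} → IsWord w → stripZ w ≡ w
word-strip {w} i = rep-strip w (i , 0 , sh-0 w)

chainOf : List ℕ → List ℕ → ℕ → Word
chainOf w ks k = stripZ (state w ks k)

path-chainId : ∀ {w ks ζ} → IsWord w → Path w ks ζ → ChainId (length ks) (chainOf w ks) ks (state w ks)
path-chainId {w} {ks} i p = refl , sym (word-strip i) ,
  (λ k _ → rep-emb (state w ks k) (rep k)) ,
  (λ k h → red⇒redEmb (state w ks k) (rep k) (proj₁ (path-steps p k h)) , proj₂ (path-steps p k h))
  where
  rep : ∀ k → Rep (at (state w ks k)) (chainOf w ks k)
  rep k = strip-rep (state w ks k) (state-con p (word-con i) k)

path-maxChain : ∀ {u w ks ζ} → IsWord w → Path w ks ζ → Rep (at ζ) u → IsMaxChain u w (length ks) (chainOf w ks)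
path-maxChain {u} {w} {ks} {ζ} i p r =
  word-strip i ,
  trans (cong stripZ (trans (state-last w ks) (path-runs p))) (rep-strip ζ r) ,
  (λ k _ → proj₁ (rep k)) , cov
  where
  rep : ∀ k → Rep (at (state w ks k)) (chainOf w ks k)
  rep k = strip-rep (state w ks k) (state-con p (word-con i) k)
  cov : ∀ k → k < length ks → Covers (chainOf w ks k) (chainOf w ks (suc k))
  cov k h = covers (proj₁ (rep k))
    (rep-≼ (step-≤ S) (rep k) rep') (trans (cong suc (sym (sum-emb (rep-emb (decAt η l) rep'))))
       (trans (sum-decAt η l (red-pos (proj₁ st))) (sum-emb (rep-emb η (rep k)))))
    where
    η = state w ks k
    l = at ks (suc k)
    st = path-steps p k h
    S = step-decAt η (proj₁ st)
    rep' : Rep (at (decAt η l)) (chainOf w ks (suc k))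
    rep' = subst (λ x → Rep (at x) (chainOf w ks (suc k))) (proj₂ st) (rep (suc k))

through-inChain : ∀ {w ks x} → Through w ks x → InChain (length ks) (chainOf w ks) x
through-inChain {w} {ks} t with through-state t
... | (k , h , r) = k , h , rep-strip (state w ks k) r

-- First letters and offsets

first-letter : ∀ {v} q → IsWord v → 1 ≤ at v q → 1 ≤ at v 1
first-letter {x ∷ v} q (h ∷ _) _ = h

nonempty : ∀ {v} → 1 ≤ at v 1 → 1 ≤ length v
nonempty {x ∷ v} _ = s≤s z≤n

sh-suc : ∀ {a f g} → Sh a f g → f (suc a) ≡ g 1
sh-suc {a} {f} (s , _) = trans (cong f (+-comm 1 a)) (s 1)

sh-least : ∀ {a f g} → Sh a f g → ∀ p → 1 ≤ f p → suc a ≤ p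
sh-least (s , z) p h = ≰⇒> λ q → pos≢0 h (z p q)

red-first : ∀ {a f g} → Sh a f g → 1 ≤ g 1 → Red f (suc a)
red-first {a} {f} s@(_ , z) h with 1 <? f (suc a)
... | yes q = inj₁ q
... | no q  = inj₂ (inj₁ (≤-antisym (≮⇒≥ q) (subst (1 ≤_) (sym (sh-suc s)) h) , λ p p≤a → z p (s≤s⁻¹ p≤a)))

sh-snoc : ∀ {a f g} v → Sh a g (at v) → f (suc (a + length v)) ≡ 1 →
          (∀ q → q ≢ suc (a + length v) → f q ≡ g q) → Sh a f (at (v ++ 1 ∷ []))
sh-snoc {a} {f} {g} v (s , z) f1 same = shift , λ p p≤a → trans (same p (λ { refl → 1+n≰n (≤-trans (s≤s (m≤m+n a (length v))) p≤a) })) (z p p≤a)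
  where
  shift : ∀ p → f (a + p) ≡ at (v ++ 1 ∷ []) p
  shift p with <-cmp p (suc (length v))
  ... | tri≈ _ refl _ = trans (cong f (+-suc a (length v))) (trans f1 (sym (at-snoc-last v 1)))
  ... | tri< lt ne _ = trans (same (a + p) (λ q → ne (+-cancelˡ-≡ a _ _ (trans q (sym (+-suc a (length v)))))))
                      (trans (s p) (sym (at-snoc-≤ v 1 p (s≤s⁻¹ lt))))
  ... | tri> _ ne gt = trans (same (a + p) (λ q → ne (+-cancelˡ-≡ a _ _ (trans q (sym (+-suc a (length v)))))))
                      (trans (s p) (trans (at-> v p (<⇒≤ gt))
                        (sym (at-> (v ++ 1 ∷ []) p (subst (_< p) (sym (length-snoc v 1)) gt)))))

word-snoc : ∀ {v} → IsWord v → IsWord (v ++ 1 ∷ [])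
word-snoc w = ++⁺ w (≤-refl ∷ [])

emb-offset : ∀ {η v} (em : EmbOf η v) → Sh (proj₁ em) (at η) (at v)
emb-offset {v = v} (a , b , refl) = emb-sh a v b

emb-lz : ∀ {η v} (em : EmbOf η v) → 1 ≤ at v 1 → lz η ≡ proj₁ em
emb-lz {v = v} (a , b , refl) h = lz-emb a (replicate b 0) h

-- Lexicographic order of chain ids

lex-++ : ∀ zs {xs ys} → LexLt xs ys → LexLt (zs ++ xs) (zs ++ ys)
lex-++ []       h = h
lex-++ (z ∷ zs) h = lex-≡ (lex-++ zs h)

lex-first : ∀ {xs ys} → LexLt xs ys → length xs ≡ length ys →
  ∃[ m ] (m < length ys × (∀ r → r < m → at xs (suc r) ≡ at ys (suc r)) × at xs (suc m) < at ys (suc m))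
lex-first (lex-< h) e = 0 , s≤s z≤n , (λ r ()) , h
lex-first (lex-≡ h) e with lex-first h (suc-injective e)
... | (m , a , b , c) = suc m , s≤s a , (λ { zero _ → refl ; (suc r) (s≤s q) → b r q }) , c

lex-irrefl : ∀ {xs} → ¬ LexLt xs xs
lex-irrefl (lex-< h) = 1+n≰n h
lex-irrefl (lex-≡ h) = lex-irrefl h

lex-asym : ∀ {xs ys} → LexLt xs ys → ¬ LexLt ys xs
lex-asym (lex-< h) (lex-< h') = <-asym h h'
lex-asym (lex-< h) (lex-≡ _)  = 1+n≰n h
lex-asym (lex-≡ _) (lex-< h)  = 1+n≰n h
lex-asym (lex-≡ h) (lex-≡ h') = lex-asym h h'

lex-cmp : ∀ xs ys → LexLe xs ys ⊎ LexLt ys xs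
lex-cmp []       []       = inj₁ (inj₁ refl)
lex-cmp []       (y ∷ ys) = inj₁ (inj₂ lex-[])
lex-cmp (x ∷ xs) []       = inj₂ lex-[]
lex-cmp (x ∷ xs) (y ∷ ys) with <-cmp x y
... | tri< h _ _ = inj₁ (inj₂ (lex-< h))
... | tri> _ _ h = inj₂ (lex-< h)
... | tri≈ _ refl _ with lex-cmp xs ys
...   | inj₁ (inj₁ refl) = inj₁ (inj₁ refl)
...   | inj₁ (inj₂ h)    = inj₁ (inj₂ (lex-≡ h))
...   | inj₂ h           = inj₂ (lex-≡ h)

lex-map : ∀ a xs ys → LexLt (map (a +_) xs) (map (a +_) ys) → LexLt xs ys
lex-map a []       (y ∷ ys) lex-[]    = lex-[]
lex-map a (x ∷ xs) (y ∷ ys) h         = go h refl refl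
  where
  go : ∀ {zs zs'} → LexLt zs zs' → zs ≡ map (a +_) (x ∷ xs) → zs' ≡ map (a +_) (y ∷ ys) → LexLt (x ∷ xs) (y ∷ ys)
  go (lex-< h) refl refl = lex-< (+-cancelˡ-< a x y h)
  go (lex-≡ h) refl eq with +-cancelˡ-≡ a x y (∷-injectiveˡ eq) | ∷-injectiveʳ eq
  ... | refl | refl = lex-≡ (lex-map a xs ys h)

tab : (ℕ → ℕ) → ℕ → List ℕ
tab f zero    = []
tab f (suc d) = f 0 ∷ tab (f ∘ suc) d

length-tab : ∀ f d → length (tab f d) ≡ d
length-tab f zero    = refl
length-tab f (suc d) = cong suc (length-tab (f ∘ suc) d)

at-tab : ∀ f {d k} → k < d → at (tab f d) (suc k) ≡ f k
at-tab f {suc d} {zero}  _       = refl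
at-tab f {suc d} {suc k} (s≤s h) = at-tab (f ∘ suc) h

-- Chains with their chain ids

module Basics (u w : Word) (n : ℕ) (v : ℕ → Word) (ls : List ℕ) (η : ℕ → List ℕ)
              (mc : IsMaxChain u w n v) (ci : ChainId n v ls η) where

  l : ℕ → ℕ
  l s = at ls (suc s)

  e : ℕ → Seq
  e s = at (η s)

  word : ∀ {k} → k ≤ n → IsWord (v k)
  word = proj₁ (proj₂ (proj₂ mc)) _

  emb : ∀ {k} → k ≤ n → EmbOf (η k) (v k)
  emb = proj₁ (proj₂ (proj₂ ci)) _

  rep : ∀ {k} → k ≤ n → Rep (e k) (v k)
  rep h = emb-rep (word h) (emb h)

  con : ∀ {k} → k ≤ n → Con (e k)
  con h = rep-con (rep h)

  reducible : ∀ {s} → s < n → Red (e s) (l s)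
  reducible {s} h = redEmb⇒red (η s) (rep (<⇒≤ h)) (proj₁ (proj₂ (proj₂ (proj₂ ci)) s h))

  next : ∀ {s} → s < n → η (suc s) ≡ decAt (η s) (l s)
  next {s} h = proj₂ (proj₂ (proj₂ (proj₂ ci)) s h)

  st : ∀ s → s < n → Step (e s) (l s) (e (suc s))
  st s h = subst (λ x → Step (e s) (l s) (at x)) (sym (next h)) (step-decAt (η s) (reducible h))

  η0 : η 0 ≡ w
  η0 = trans (proj₁ (proj₂ ci)) (proj₁ mc)

  open Chain e l n st public

  seg : ℕ → ℕ → List ℕ
  seg s zero    = []
  seg s (suc d) = l s ∷ seg (suc s) d

  seg-length : ∀ s d → length (seg s d) ≡ d
  seg-length s zero    = refl
  seg-length s (suc d) = cong suc (seg-length (suc s) d)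

  seg-++ : ∀ s d d' → seg s (d + d') ≡ seg s d ++ seg (s + d) d'
  seg-++ s zero    d' = cong (λ x → seg x d') (sym (+-identityʳ s))
  seg-++ s (suc d) d' = cong (l s ∷_) (trans (seg-++ (suc s) d d')
    (cong (λ x → seg (suc s) d ++ seg x d') (sym (+-suc s d))))

  seg-path : ∀ s d → s + d ≤ n → Path (η s) (seg s d) (η (s + d))
  seg-path s zero    h = subst (λ x → Path (η s) [] (η x)) (sym (+-identityʳ s)) done
  seg-path s (suc d) h = reducible s<n ∷
    subst₂ (λ x y → Path x (seg (suc s) d) (η y)) (next s<n) (sym (+-suc s d)) (seg-path (suc s) d h')
    where
    h' : suc s + d ≤ n
    h' = subst (_≤ n) (+-suc s d) h
    s<n : s < n
    s<n = ≤-trans (m≤m+n (suc s) d) h'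

  seg-through : ∀ s d q → q ≤ d → s + d ≤ n → Through (η s) (seg s d) (v (s + q))
  seg-through s d zero _ h = subst (Through (η s) (seg s d)) (cong v (sym (+-identityʳ s)))
    (now (rep (≤-trans (m≤m+n s d) h)))
  seg-through s (suc d) (suc q) (s≤s q≤d) h = later
    (subst₂ (λ x y → Through x (seg (suc s) d) (v y)) (next s<n) (sym (+-suc s q)) (seg-through (suc s) d q q≤d h'))
    where
    h' : suc s + d ≤ n
    h' = subst (_≤ n) (+-suc s d) h
    s<n : s < n
    s<n = ≤-trans (m≤m+n (suc s) d) h'

  seg-≡ : ∀ xs d s → length xs ≡ d → (∀ q → q < d → at xs (suc q) ≡ l (s + q)) → xs ≡ seg s d
  seg-≡ []       zero    s _  _ = refl
  seg-≡ (x ∷ xs) (suc d) s eq h = cong₂ _∷_ (trans (h 0 (s≤s z≤n)) (cong l (+-identityʳ s)))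
    (seg-≡ xs d (suc s) (suc-injective eq) (λ q lt → trans (h (suc q) (s≤s lt)) (cong l (+-suc s q))))

  seg-all : ls ≡ seg 0 n
  seg-all = seg-≡ ls n 0 (proj₁ ci) (λ _ _ → refl)

  sum-v : ∀ {k} → k ≤ n → sum w ≡ k + sum (v k)
  sum-v {k} h = trans (cong sum (sym η0)) (trans (path-sum (seg-path 0 k h))
    (cong₂ _+_ (seg-length 0 k) (sum-emb (emb h))))

  -- Each step lowers the letter sum by one, so a word determines its index; inclusions between sets
  -- of chain words become inequalities between indices.
  v-injective : ∀ {k k'} → k ≤ n → k' ≤ n → v k ≡ v k' → k ≡ k'
  v-injective {k} {k'} h h' q = +-cancelʳ-≡ (sum (v k)) k k'
    (trans (sym (sum-v h)) (trans (sum-v h') (cong (λ x → k' + sum x) (sym q))))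

-- Skipped intervals as earlier sequences of reductions

module Given (u w : Word) (n : ℕ) (v : ℕ → Word) (ls : List ℕ) (η : ℕ → List ℕ) (iw : IsWord w)
             (mc : IsMaxChain u w n v) (ci : ChainId n v ls η) where

  open Basics u w n v ls η mc ci

  -- Follow the chain down to `v s`, take the detour, then replay the rest of the chain at whatever
  -- embedding of `v t` the detour reached. The ids first differ at `l s`, where `k` is smaller.
  skipped-intro : ∀ {s t k ks ζ} → s < t → t ≤ n → Path (η s) (k ∷ ks) ζ → k < l s → Rep (at ζ) (v t) →
                  Skipped u w n v ls s t
  skipped-intro {s} {t} {k} {ks} {ζ} s<t t≤n P k<l rζ =
    s<t , t≤n , (v (suc s) , suc s , ≤-refl , ≤∧≢⇒< s<t not-next , refl) ,
    length LS , chainOf w LS , LS , state w LS ,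
    path-maxChain iw path (re' u ru) , path-chainId iw path , lex , inc
    where
    s<n : s < n
    s<n = <-≤-trans s<t t≤n
    -- If `t` were `suc s`, the letter sums would force `ks` to be empty, and two different
    -- reductions of `η s` would give the same word.
    not-next : suc s ≢ t
    not-next refl = <⇒≢ k<l (step-unique (con (<⇒≤ s<n)) (step-decAt (η s) (red-head P)) (st s s<n)
                              (end ks (+-cancelʳ-≡ (sum (v (suc s))) (length ks) 0 short) P) (rep t≤n))
      where
      red-head : ∀ {η k ks ζ} → Path η (k ∷ ks) ζ → Red (at η) k
      red-head (r ∷ _) = r
      end : ∀ ks → length ks ≡ 0 → Path (η s) (k ∷ ks) ζ → Rep (at (decAt (η s) k)) (v (suc s))
      end [] _ (_ ∷ done) = rζ
      short : length ks + sum (v (suc s)) ≡ sum (v (suc s))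
      short = suc-injective (trans (cong (suc (length ks) +_) (sym (sum-emb (rep-emb ζ rζ))))
        (trans (sym (path-sum P)) (trans (sym (sum-decAt (η s) (l s) (red-pos (reducible s<n))))
          (cong suc (trans (cong sum (sym (next s<n))) (sum-emb (emb t≤n)))))))
    t+ : t + (n ∸ t) ≡ n
    t+ = m+[n∸m]≡n t≤n
    tail : Path (η t) (seg t (n ∸ t)) (η n)
    tail = subst (λ x → Path (η t) (seg t (n ∸ t)) (η x)) t+ (seg-path t (n ∸ t) (≤-reflexive t+))
    tr = transport (v t) (proj₂ (proj₂ (rep t≤n))) (proj₂ (proj₂ rζ)) tail
    ks' = proj₁ tr
    through' = proj₁ (proj₂ (proj₂ (proj₂ tr)))
    re' = proj₂ (proj₂ (proj₂ (proj₂ tr)))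
    ru : Rep (e n) u
    ru = subst (Rep (e n)) (proj₁ (proj₂ mc)) (rep ≤-refl)
    LS = seg 0 s ++ (k ∷ ks) ++ ks'
    to-s : Path w (seg 0 s) (η s)
    to-s = subst (λ x → Path x (seg 0 s) (η s)) η0 (seg-path 0 s (<⇒≤ s<n))
    path : Path w LS (proj₁ (proj₂ tr))
    path = path-++ to-s (path-++ P (proj₁ (proj₂ (proj₂ tr))))
    lex : LexLt LS ls
    lex = subst (LexLt LS) (sym (trans seg-all
            (trans (cong (seg 0) (sym (m+[n∸m]≡n (<⇒≤ s<n)))) (trans (seg-++ 0 s (n ∸ s))
              (cong (λ x → seg 0 s ++ seg s x) (sym (m+[n∸m]≡n (m<n⇒0<n∸m s<n))))))))
            (lex-++ (seg 0 s) (lex-< k<l))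
    inc : ∀ x → InChain n v x → ¬ InInt v s t x → InChain (length LS) (chainOf w LS) x
    inc x (q , q≤n , refl) out with q ≤? s
    ... | yes q≤s = through-inChain (through-++ˡ _
            (subst (λ z → Through z (seg 0 s) (v q)) η0 (seg-through 0 s q q≤s (<⇒≤ s<n))))
    ... | no q≰s with t ≤? q
    ...   | no t≰q  = ⊥-elim (out (q , ≰⇒> q≰s , ≰⇒> t≰q , refl))
    ...   | yes t≤q = through-inChain (through-++ʳ to-s (through-++ʳ P (through' (v q)
              (subst (Through (η t) (seg t (n ∸ t))) (cong v (m+[n∸m]≡n t≤q))
                (seg-through t (n ∸ t) (q ∸ t) (∸-monoˡ-≤ t q≤n) (≤-reflexive t+))))))

  -- By their letter sums, the words outside the interval have the same indices in both chains. Up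
  -- to the first difference `m` of the ids the embeddings agree, and by `step-unique` the next
  -- words differ; so `suc m` is strictly between `s` and `t`.
  skipped-elim : ∀ {s t} → Skipped u w n v ls s t →
    ∃[ m ] ∃[ k ] ∃[ ks ] ∃[ ζ ] (s ≤ m × suc (suc m) ≤ t × Path (η m) (k ∷ ks) ζ × k < l m × Rep (at ζ) (v t))
  skipped-elim {s} {t} (s<t , t≤n , _ , n' , v' , ls' , η' , mc' , ci' , lex , inc) =
    m , l' m , seg' (suc m) d , η' t , s≤m , m+2≤t , path , m< , subst (Rep (at (η' t))) (kept t≤n (inj₂ ≤-refl)) (rep' (subst (t ≤_) (sym n≡) t≤n))
    where
    open Basics u w n' v' ls' η' mc' ci' renaming
      (l to l'; e to e'; rep to rep'; sum-v to sum-v'; seg to seg'; seg-path to seg-path'; η0 to η0'; next to next'; st to st')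
      using ()
    n≡ : n' ≡ n
    n≡ = +-cancelʳ-≡ (sum u) n' n (trans (cong (λ x → n' + sum x) (sym (proj₁ (proj₂ mc'))))
           (trans (sym (sum-v' ≤-refl)) (trans (sum-v ≤-refl) (cong (λ x → n + sum x) (proj₁ (proj₂ mc))))))
    kept : ∀ {q} → q ≤ n → q ≤ s ⊎ t ≤ q → v' q ≡ v q
    kept {q} q≤n side with inc (v q) (q , q≤n , refl) out
      where
      out : ¬ InInt v s t (v q)
      out (k , s<k , k<t , eq) with v-injective (≤-trans (<⇒≤ k<t) t≤n) q≤n eq
      ... | refl = [ (λ q≤s → 1+n≰n (≤-trans s<k q≤s)) , (λ t≤q → 1+n≰n (≤-trans k<t t≤q)) ]′ side
    ... | (q' , q'≤ , eq) = subst (λ x → v' x ≡ v q) (+-cancelʳ-≡ (sum (v q)) q' q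
            (trans (cong (λ x → q' + sum x) (sym eq)) (trans (sym (sum-v' q'≤)) (sum-v q≤n)))) eq
    fd = lex-first lex (trans (proj₁ ci') (trans n≡ (sym (proj₁ ci))))
    m = proj₁ fd
    m<n : m < n
    m<n = subst (m <_) (proj₁ ci) (proj₁ (proj₂ fd))
    m<n' : m < n'
    m<n' = subst (m <_) (sym n≡) m<n
    m< : l' m < l m
    m< = proj₂ (proj₂ (proj₂ fd))
    agree : ∀ r → r ≤ m → η' r ≡ η r
    agree zero    _ = trans η0' (sym η0)
    agree (suc r) h = trans (next' (<-trans h m<n')) (trans
      (cong₂ decAt (agree r (<⇒≤ h)) (proj₁ (proj₂ (proj₂ fd)) r h)) (sym (next (<-trans h m<n))))
    differ : v' (suc m) ≢ v (suc m)
    differ eq = <⇒≢ m< (step-unique (con (<⇒≤ m<n))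
      (subst (λ x → Step (at x) (l' m) (e' (suc m))) (agree m ≤-refl) (st' m m<n')) (st m m<n)
      (subst (Rep (e' (suc m))) eq (rep' m<n')) (rep m<n))
    s≤m : s ≤ m
    s≤m = ≮⇒≥ λ q → differ (kept m<n (inj₁ q))
    m+2≤t : suc (suc m) ≤ t
    m+2≤t = ≰⇒> λ q → differ (kept m<n (inj₂ q))
    d = t ∸ suc m
    md : suc m + d ≡ t
    md = m+[n∸m]≡n (<⇒≤ m+2≤t)
    path : Path (η m) (l' m ∷ seg' (suc m) d) (η' t)
    path = subst₂ (λ x y → Path x (l' m ∷ seg' (suc m) d) (η' y)) (agree m ≤-refl) (trans (+-suc m d) md)
      (seg-path' m (suc d) (subst (_≤ n') (sym (trans (+-suc m d) md)) (subst (t ≤_) (sym n≡) t≤n)))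

  -- An embedding of v t that avoids the first letter of v s is reached by first reducing that letter.
  skipped-offset : ∀ {s t a c} → s < t → t ≤ n → NF (at (v t)) → Sh a (e s) (at (v s)) →
    suc c + length (v t) ≤ length (v s) → (∀ q → 1 ≤ q → q ≤ length (v t) → at (v t) q ≤ at (v s) (suc c + q)) →
    suc a < l s → Skipped u w n v ls s t
  skipped-offset {s} {t} {a} {c} s<t t≤n nf sh len le a<l =
    skipped-intro s<t t≤n (first ∷ proj₂ rest) a<l (word t≤n , a + suc c , shζ)
    where
    s≤n = ≤-trans (<⇒≤ s<t) t≤n
    vs-pos : 1 ≤ length (v s)
    vs-pos = ≤-trans (s≤s z≤n) len
    vs1 : 1 ≤ at (v s) 1
    vs1 = word-at (word s≤n) 1 ≤-refl vs-pos
    first : Red (e s) (suc a)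
    first = red-first sh vs1
    size = a + suc c + length (v t)
    b = length (η s) ∸ size
    ζ = replicate (a + suc c) 0 ++ v t ++ replicate b 0
    shζ : Sh (a + suc c) (at ζ) (at (v t))
    shζ = emb-sh (a + suc c) (v t) b
    vs≤η : a + length (v s) ≤ length (η s)
    vs≤η = at-pos⇒≤ (η s) _ (subst (1 ≤_) (sym (proj₁ sh (length (v s)))) (word-at (word s≤n) _ vs-pos ≤-refl))
    size≤ : size ≤ length (η s)
    size≤ = ≤-trans (≤-reflexive (+-assoc a (suc c) (length (v t)))) (≤-trans (+-monoʳ-≤ a len) vs≤η)
    lenζ : length ζ ≡ length (η s)
    lenζ = trans (length-++ (replicate (a + suc c) 0)) (trans (cong₂ _+_ (length-replicate (a + suc c))
             (trans (length-++ (v t)) (cong (length (v t) +_) (length-replicate b))))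
             (trans (sym (+-assoc (a + suc c) (length (v t)) b)) (m+[n∸m]≡n size≤)))
    ζ≤ : ∀ p → at ζ p ≤ e s p
    ζ≤ p with split (a + suc c) p
    ... | inj₁ h = subst (_≤ e s p) (sym (proj₂ shζ p h)) z≤n
    ... | inj₂ (q , refl) = subst₂ _≤_ (sym (proj₁ shζ (suc q)))
            (trans (sym (proj₁ sh (suc c + suc q))) (cong (e s) (sym (+-assoc a (suc c) (suc q))))) letter
      where
      letter : at (v t) (suc q) ≤ at (v s) (suc c + suc q)
      letter with suc q ≤? length (v t)
      ... | yes h = le (suc q) (s≤s z≤n) h
      ... | no h  = subst (_≤ at (v s) (suc c + suc q)) (sym (at-> (v t) (suc q) (≰⇒> h))) z≤n
    ζ< : at ζ (suc a) < e s (suc a)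
    ζ< = subst (_< e s (suc a)) (sym (proj₂ shζ (suc a) (subst (suc a ≤_) (sym (+-suc a c)) (s≤s (m≤m+n a c)))))
           (red-pos first)
    rest = path-exists ζ (rep-con (word t≤n , a + suc c , shζ)) (sh-nf shζ nf) (decAt (η s) (suc a))
             (trans lenζ (sym (length-decAt (η s) (suc a)))) (dec-≤ (η s) first ζ< ζ≤)

  -- Strong descents

  swap-path : ∀ {s} → suc (suc s) ≤ n → l (suc s) < l s → Red (e s) (l (suc s)) →
    NF (at (decAt (η s) (l (suc s)))) → Path (η s) (l (suc s) ∷ l s ∷ []) (η (suc (suc s)))
  swap-path {s} h d r nf = r ∷ red T' ∷ subst (Path ζ []) same done
    where
    S = st s (<⇒≤ h)
    S' = st (suc s) h
    η₁ = decAt (η s) (l (suc s))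
    T' : Step (at η₁) (l s) (e (suc (suc s)))
    T' = swap-nf S S' d (step-decAt (η s) r) nf
    ζ = decAt η₁ (l s)
    T'' = step-decAt η₁ (red T')
    same : ζ ≡ η (suc (suc s))
    same = at-ext ζ _ (trans (length-decAt η₁ (l s)) (trans (length-decAt (η s) (l (suc s)))
        (sym (trans (cong length (next h)) (trans (length-decAt (η (suc s)) (l (suc s)))
             (trans (cong length (next (<⇒≤ h))) (length-decAt (η s) (l s)))))))) eq
      where
      eq : ∀ p → at ζ p ≡ e (suc (suc s)) p
      eq p with p ≟ l s
      ... | yes refl = suc-injective (trans (sym (here T'')) (here T'))
      ... | no ne    = trans (there T'' p ne) (sym (there T' p ne))

  descent-red : ∀ {s} → suc (suc s) ≤ n → l (suc s) < l s → ¬ TT (e s) (l s) (l (suc s)) → Red (e s) (l (suc s))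
  descent-red {s} h d ¬tt = swap-red (con (<⇒≤ (<⇒≤ h))) (st s (<⇒≤ h)) (st (suc s) h) d ¬tt

  -- Reduce the left letter first. If this leaves a letter ≥ 2, the other reduction follows;
  -- otherwise the first letter of the flat word is removed instead.
  descent-skipped : ∀ {s} → suc (suc s) ≤ n → l (suc s) < l s → ¬ TT (e s) (l s) (l (suc s)) →
    Skipped u w n v ls s (suc (suc s))
  descent-skipped {s} h d ¬tt with nf? (decAt (η s) (l (suc s)))
  ... | inj₁ nf   = skipped-intro (n≤1+n (suc s)) h (swap-path h d (descent-red h d ¬tt) nf) d (rep h)
  ... | inj₂ flat = skipped-intro (n≤1+n (suc s)) h (r ∷ F.reducible ∷ done) d
                      (word h , _ , F.shifted (step-decAt (decAt (η s) (l (suc s))) F.reducible))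
    where
    r : Red (e s) (l (suc s))
    r = descent-red h d ¬tt
    module F = SwapFlat (con (<⇒≤ (<⇒≤ h))) (st s (<⇒≤ h)) (st (suc s) h) d (step-decAt (η s) r) flat
                        (word h) (proj₂ (proj₂ (rep h)))

  snoc-snoc : ∀ (x : Word) → (x ++ 1 ∷ []) ++ 1 ∷ [] ≡ x ++ 1 ∷ 1 ∷ []
  snoc-snoc x = ++-assoc x (1 ∷ []) (1 ∷ [])

  -- The final 1 at `l s` was not the first letter, so there is a letter ≥ 2, and it survives both
  -- steps. Hence the remaining word is nonempty, and by contiguity it ends right before the removed
  -- pair.
  TT⇒≡ : ∀ {s} → suc (suc s) ≤ n → l (suc s) < l s → TT (e s) (l s) (l (suc s)) → v s ≡ v (suc (suc s)) ++ (1 ∷ 1 ∷ [])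
  TT⇒≡ {s} h d (ab , fa , fb , z) =
    trans (rep-unique (rep (<⇒≤ (<⇒≤ h))) (word-snoc (word-snoc (word h)) , c , sh₂)) (snoc-snoc x)
    where
    S = st s (<⇒≤ h)
    S' = st (suc s) h
    x = v (suc (suc s))
    b = l (suc s)
    c = proj₁ (proj₂ (rep h))
    sh₀ : Sh c (e (suc (suc s))) (at x)
    sh₀ = proj₂ (proj₂ (rep h))
    gb : e (suc s) b ≡ 1
    gb = trans (there S b (<⇒≢ d)) fb
    hb : e (suc (suc s)) b ≡ 0
    hb = suc-injective (trans (sym (here S')) gb)
    ha : e (suc (suc s)) (l s) ≡ 0
    ha = trans (there S' (l s) (≢-sym (<⇒≢ d))) (suc-injective (trans (sym (here S)) fa))
    nf : NF (e (suc (suc s)))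
    nf with proj₁ (red-not-first (red S) fa d (≤-reflexive (sym fb)))
    ... | (q , f2) = q , subst (2 ≤_) (sym (trans (there S' q (λ { refl → <⇒≢ f2 (sym fb) }))
                                                  (there S q (λ { refl → <⇒≢ f2 (sym fa) })))) f2
    x1 : 1 ≤ at x 1
    x1 with sh-nf↓ sh₀ nf
    ... | (q , x2) = first-letter q (word h) (<⇒≤ x2)
    end : 1 ≤ e (suc (suc s)) (c + length x)
    end = subst (1 ≤_) (sym (proj₁ sh₀ (length x))) (word-at (word h) (length x) (nonempty {x} x1) ≤-refl)
    beyond : e (suc (suc s)) (suc (c + length x)) ≡ 0
    beyond = trans (cong (e (suc (suc s))) (sym (+-suc c (length x))))
                   (trans (proj₁ sh₀ (suc (length x))) (at-> x (suc (length x)) ≤-refl))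
    end<b : c + length x < b
    end<b = ≰⇒> λ q → pos≢0 end (zeros (c + length x) q)
      where
      zeros : ∀ p → b ≤ p → e (suc (suc s)) p ≡ 0
      zeros p b≤p with m≤n⇒m<n∨m≡n b≤p
      ... | inj₂ refl = hb
      ... | inj₁ b<p with m≤n⇒m<n∨m≡n (subst (_≤ p) (sym ab) b<p)
      ...   | inj₂ refl = ha
      ...   | inj₁ a<p  = ≤0 (step-≤ S' p) (≤0 (step-≤ S p) (z p a<p))
    b≡ : b ≡ suc (c + length x)
    b≡ with m≤n⇒m<n∨m≡n end<b
    ... | inj₂ q = sym q
    ... | inj₁ q = ⊥-elim (pos≢0 (con (<⇒≤ h) (c + length x) (suc (c + length x)) b ≤-refl q
                            (≤-trans end (step-≤ S' _)) (≤-reflexive (sym gb)))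
                            (trans (sym (there S' _ (<⇒≢ q))) beyond))
    sh₁ : Sh c (e (suc s)) (at (x ++ 1 ∷ []))
    sh₁ = sh-snoc x sh₀ (trans (cong (e (suc s)) (sym b≡)) gb)
            (λ q ne → sym (there S' q (λ r → ne (trans r b≡))))
    a≡ : l s ≡ suc (c + length (x ++ 1 ∷ []))
    a≡ = trans ab (cong suc (trans b≡ (trans (sym (+-suc c (length x))) (cong (c +_) (sym (length-snoc x 1))))))
    sh₂ : Sh c (e s) (at ((x ++ 1 ∷ []) ++ 1 ∷ []))
    sh₂ = sh-snoc (x ++ 1 ∷ []) sh₁ (trans (cong (e s) (sym a≡)) fa)
            (λ q ne → sym (there S q (λ r → ne (trans r a≡))))

  -- Two letters disappear, so the descent zeroes the right one of them first; this must be the last letter.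
  ≡⇒TT : ∀ {s} → suc (suc s) ≤ n → l (suc s) < l s → v s ≡ v (suc (suc s)) ++ (1 ∷ 1 ∷ []) → TT (e s) (l s) (l (suc s))
  ≡⇒TT {s} h d eq = trans lsP (cong suc (sym bP)) , trans (cong (e s) lsP) eP , trans (cong (e s) bP) eQ ,
      λ p lt → beyond p (subst (_< p) lsP lt)
    where
    s≤n = <⇒≤ (<⇒≤ h)
    S = st s (<⇒≤ h)
    S' = st (suc s) h
    x = v (suc (suc s))
    y = x ++ 1 ∷ []
    a = proj₁ (proj₂ (rep s≤n))
    sh : Sh a (e s) (at (y ++ 1 ∷ []))
    sh = subst (λ z → Sh a (e s) (at z)) (trans eq (sym (snoc-snoc x))) (proj₂ (proj₂ (rep s≤n)))
    c = proj₁ (proj₂ (rep h))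
    sh' : Sh c (e (suc (suc s))) (at x)
    sh' = proj₂ (proj₂ (rep h))
    m = length x
    Q = suc (a + m)
    P = suc Q
    P≡ : P ≡ a + suc (length y)
    P≡ = trans (cong suc (trans (sym (+-suc a m)) (cong (a +_) (sym (length-snoc x 1))))) (sym (+-suc a (length y)))
    Q≡ : Q ≡ a + length y
    Q≡ = trans (sym (+-suc a m)) (cong (a +_) (sym (length-snoc x 1)))
    eP : e s P ≡ 1
    eP = trans (cong (e s) P≡) (trans (proj₁ sh (suc (length y))) (at-snoc-last y 1))
    eQ : e s Q ≡ 1
    eQ = trans (cong (e s) Q≡) (trans (proj₁ sh (length y)) (trans (at-snoc-≤ y 1 (length y) ≤-refl)
           (trans (cong (at y) (length-snoc x 1)) (at-snoc-last x 1))))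
    beyond : ∀ p → P < p → e s p ≡ 0
    beyond p P<p with split a p
    ... | inj₁ p≤a = proj₂ sh p p≤a
    ... | inj₂ (q , refl) = trans (proj₁ sh (suc q)) (at-> (y ++ 1 ∷ []) (suc q)
            (subst (_< suc q) (sym (length-snoc y 1)) (+-cancelˡ-< a _ _ (subst (_< a + suc q) P≡ P<p))))
    pos : ∀ p → a < p → p ≤ P → 1 ≤ e s p
    pos p a<p p≤P with split a p
    ... | inj₁ p≤a = ⊥-elim (1+n≰n (≤-trans a<p p≤a))
    ... | inj₂ (q , refl) = subst (1 ≤_) (sym (proj₁ sh (suc q)))
            (word-at (word-snoc (word-snoc (word h))) (suc q) (s≤s z≤n)
              (subst (suc q ≤_) (sym (length-snoc y 1)) (+-cancelˡ-≤ a _ _ (subst (a + suc q ≤_) P≡ p≤P))))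
    gone : ∀ p → c + m < p → e (suc (suc s)) p ≡ 0
    gone p lt with split c p
    ... | inj₁ p≤c = proj₂ sh' p p≤c
    ... | inj₂ (q , refl) = trans (proj₁ sh' (suc q)) (at-> x (suc q) (+-cancelˡ-< c _ _ lt))
    -- The reduction further left comes second, so of two vanished positions the right one is `l s`.
    two : ∀ p p' → p < p' → a < p → p' ≤ P → e (suc (suc s)) p ≡ 0 → e (suc (suc s)) p' ≡ 0 → l s ≡ p' × e s (l s) ≡ 1
    two p p' p<p' a<p p'≤P z z' with p' ≟ l s
    ... | yes refl = refl , step-0-val S (trans (sym (there S' p' (≢-sym (<⇒≢ d)))) z')
    ... | no ne with p ≟ l s
    ...   | yes refl = ⊥-elim (<-asym d (subst (p <_) (step-0 S' p' (subst (1 ≤_) (sym (there S p' ne)) (pos p' (<-trans a<p p<p') p'≤P)) z') p<p'))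
    ...   | no ne' = ⊥-elim (<⇒≢ p<p' (trans (step-0 S' p (subst (1 ≤_) (sym (there S p ne')) (pos p a<p (≤-trans (<⇒≤ p<p') p'≤P))) z)
               (sym (step-0 S' p' (subst (1 ≤_) (sym (there S p' ne)) (pos p' (<-trans a<p p<p') p'≤P)) z'))))
    a<Q : a < Q
    a<Q = s≤s (m≤m+n a m)
    vanish : e s (l s) ≡ 1
    -- Depending on where `x` starts, the vanished positions include the last two of `v s`, the
    -- first and the last, or the first two.
    vanish with <-cmp c (suc a)
    ... | tri< c≤a _ _ = proj₂ (two Q P ≤-refl a<Q ≤-refl (gone Q (s≤s (+-monoˡ-≤ m (s≤s⁻¹ c≤a))))
                           (gone P (≤-trans (s≤s (+-monoˡ-≤ m (s≤s⁻¹ c≤a))) (n≤1+n Q))))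
    ... | tri≈ _ c≡ _  = proj₂ (two (suc a) P (s≤s a<Q) ≤-refl ≤-refl (proj₂ sh' (suc a) (≤-reflexive (sym c≡)))
                           (gone P (≤-reflexive (cong (λ z → suc (z + m)) c≡))))
    ... | tri> _ _ c>  = proj₂ (two (suc a) (suc (suc a)) ≤-refl ≤-refl (s≤s a<Q)
                           (proj₂ sh' (suc a) (<⇒≤ c>)) (proj₂ sh' (suc (suc a)) c>))
    fb : 1 ≤ e s (l (suc s))
    fb = ≤-trans (red-pos (red S')) (step-≤ S _)
    last = red-not-first (red S) vanish d fb
    lsP : l s ≡ P
    lsP = ≤-antisym (≮⇒≥ λ q → pos≢0 (red-pos (red S)) (beyond (l s) q))
                    (≮⇒≥ λ q → pos≢0 (≤-reflexive (sym eP)) (proj₂ last P q))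
    gQ : e (suc s) Q ≡ 1
    gQ = trans (there S Q (λ q → 1+n≢n (sym (trans q lsP)))) eQ
    nf : NF (e (suc s))
    nf with proj₁ last
    ... | (q , f2) = q , subst (2 ≤_) (sym (there S q (λ { refl → <⇒≢ f2 (sym vanish) }))) f2
    above : ∀ p → Q < p → e (suc s) p ≡ 0
    above p Q<p with m≤n⇒m<n∨m≡n Q<p
    ... | inj₁ P<p  = ≤0 (step-≤ S p) (beyond p P<p)
    ... | inj₂ refl = subst (λ z → e (suc s) z ≡ 0) lsP (suc-injective (trans (sym (here S)) vanish))
    -- Reducing `Q` now would lead to `x`, so by `step-unique` this is what the chain does.
    rQ : Red (e (suc s)) Q
    rQ = inj₂ (inj₂ (nf , gQ , above))
    T = step-decAt (η (suc s)) rQ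
    shT : Sh a (at (decAt (η (suc s)) Q)) (at x)
    shT = shift , λ p p≤a → ≤0 (step-≤ T p) (≤0 (step-≤ S p) (proj₂ sh p p≤a))
      where
      shift : ∀ p → at (decAt (η (suc s)) Q) (a + p) ≡ at x p
      shift p with <-cmp p (suc m)
      ... | tri< lt ne _ = trans (there T (a + p) (<⇒≢ ap<Q))
             (trans (there S (a + p) (λ q → <⇒≢ (<-trans ap<Q ≤-refl) (trans q lsP)))
             (trans (proj₁ sh p) (trans (at-snoc-≤ y 1 p (≤-trans (<⇒≤ lt) (≤-reflexive (sym (length-snoc x 1)))))
                                        (at-snoc-≤ x 1 p (s≤s⁻¹ lt)))))
        where
        ap<Q : a + p < Q
        ap<Q = s≤s (+-monoʳ-≤ a (s≤s⁻¹ lt))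
      ... | tri≈ _ refl _ = trans (cong (at (decAt (η (suc s)) Q)) (+-suc a m))
             (trans (suc-injective (trans (sym (here T)) gQ)) (sym (at-> x (suc m) ≤-refl)))
      ... | tri> _ _ gt = trans (≤0 (step-≤ T (a + p)) (above (a + p) (subst (_< a + p) (+-suc a m) (+-monoʳ-< a gt))))
                                (sym (at-> x p (<⇒≤ gt)))
    bP : l (suc s) ≡ Q
    bP = sym (step-unique (con (<⇒≤ h)) T S' (word h , a , shT) (rep h))

  -- Offsets along the chain and comparison with an earlier chain

  same-offset : ∀ {i s j a} → i ≤ s → s ≤ j → j ≤ n → Sh a (e i) (at (v i)) → 1 ≤ e j (suc a) → Sh a (e s) (at (v s))
  same-offset {i} {s} {j} {a} i≤s s≤j j≤n sh pos = subst (λ c → Sh c (e s) (at (v s))) c≡a shs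
    where
    s≤n = ≤-trans s≤j j≤n
    c = proj₁ (proj₂ (rep s≤n))
    shs : Sh c (e s) (at (v s))
    shs = proj₂ (proj₂ (rep s≤n))
    pos-s : 1 ≤ e s (suc a)
    pos-s = ≤-trans pos (mono s≤j j≤n (suc a))
    vs1 : 1 ≤ at (v s) 1
    vs1 with sh-pos shs pos-s
    ... | (q , eq) = first-letter (suc q) (word s≤n) (subst (1 ≤_) (trans (cong (e s) eq) (proj₁ shs (suc q))) pos-s)
    -- `v s` starts no later than `suc a`, where a letter survives, and no earlier, because its
    -- embedding lies below that of `v i`.
    c≡a : c ≡ a
    c≡a = ≤-antisym (s≤s⁻¹ (sh-least shs (suc a) pos-s))
      (s≤s⁻¹ (sh-least sh (suc c) (≤-trans (subst (1 ≤_) (sym (sh-suc shs)) vs1) (mono i≤s s≤n (suc c)))))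

  at-mono : ∀ {s t a} → s ≤ t → t ≤ n → Sh a (e s) (at (v s)) → Sh a (e t) (at (v t)) → ∀ q → at (v t) q ≤ at (v s) q
  at-mono s≤t t≤n (s , _) (s' , _) q = subst₂ _≤_ (s' q) (s q) (mono s≤t t≤n _)

  -- Turns the lowered word in the definition of a principal factor into the next word of the chain.
  strip-next : ∀ {s a k} → s < n → Sh a (e s) (at (v s)) → l s ≡ a + k → stripZ (decAt (v s) k) ≡ v (suc s)
  strip-next {s} {a} {k} s<n sh eq = rep-strip (decAt (v s) k) (sh-rep sh' (sh-0 (decAt (v s) k)) (rep s<n))
    where
    r : Red (e s) (a + k)
    r = subst (Red (e s)) eq (reducible s<n)
    sh' : Sh a (e (suc s)) (at (decAt (v s) k))
    sh' = sh-step sh (subst (λ x → Step (e s) x (e (suc s))) eq (st s s<n)) (step-decAt (v s) (sh-red↓ sh r))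

  -- The position right after the end of `v (suc t)` has been emptied, while the last letter of
  -- `v (suc t)` is kept; this is the situation of `last-step`.
  final-step : ∀ {m t a} → m < suc t → suc t ≤ n → NSD m (suc t) → Sh a (e m) (at (v m)) →
    Sh a (e (suc t)) (at (v (suc t))) → 1 ≤ length (v (suc t)) → length (v (suc t)) < length (v m) →
    l t ≡ suc (a + length (v (suc t))) × e t (suc (a + length (v (suc t)))) ≡ 1 ×
    (∀ q → suc (a + length (v (suc t))) < q → e t q ≡ 0) × NF (e (suc t))
  final-step {m} {t} {a} m<t t<n nsd sh sh' ne lt = last-step m<t t<n nsd (a + len)
    (trans (cong (e (suc t)) (sym (+-suc a len))) (trans (proj₁ sh' (suc len)) (at-> (v (suc t)) (suc len) ≤-refl)))
    (subst (1 ≤_) (sym (trans (cong (e m) (sym (+-suc a len))) (proj₁ sh (suc len))))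
       (word-at (word (≤-trans (<⇒≤ m<t) t<n)) (suc len) (s≤s z≤n) lt))
    (subst (1 ≤_) (sym (proj₁ sh' len)) (word-at (word t<n) len ne ≤-refl))
    where
    len = length (v (suc t))

  -- A chain without strong descents keeps every letter that an earlier chain reduces first, in
  -- particular the first one, so the earlier chain ends at an embedding further right.
  analysis : ∀ {m t a k ks ζ} → m < t → t ≤ n → NSD m t → Sh a (e m) (at (v m)) →
    Path (η m) (k ∷ ks) ζ → k < l m → Rep (at ζ) (v t) →
    Sh a (e t) (at (v t)) × suc a < l m × e t (suc a) ≡ e m (suc a) × 1 ≤ e t (suc a) × NF (at (v t)) ×
    ∃[ d ] (suc d + length (v t) ≤ length (v m) × (∀ q → at (v t) q ≤ at (v m) (suc d + q)))
  analysis {m} {suc t} {a} {k} {ks} {ζ} m<t t≤n nsd sh path@(r ∷ rest) k<l (wt , c , shζ) =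
    sht , a<l , kept , pos , sh-nf↓ sht (proj₂ (proj₂ (proj₂ final))) , d , len , letters
    where
    m≤n = ≤-trans (<⇒≤ m<t) t≤n
    vm1 : 1 ≤ at (v m) 1
    vm1 with sh-pos sh (red-pos r)
    ... | (q , eq) = first-letter (suc q) (word m≤n) (subst (1 ≤_) (trans (cong (e m) eq) (proj₁ sh (suc q))) (red-pos r))
    a<l : suc a < l m
    a<l = ≤-<-trans (sh-least sh k (red-pos r)) k<l
    kept : e (suc t) (suc a) ≡ e m (suc a)
    kept = first-kept m<t t≤n nsd (suc a) a<l (red-first sh vm1)
    pos : 1 ≤ e (suc t) (suc a)
    pos = subst (1 ≤_) (sym kept) (red-pos (red-first sh vm1))
    sht : Sh a (e (suc t)) (at (v (suc t)))
    sht = same-offset (<⇒≤ m<t) ≤-refl t≤n sh pos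
    vt1 : 1 ≤ at (v (suc t)) 1
    vt1 = subst (1 ≤_) (sh-suc sht) pos
    ζ<e : at ζ k < e m k
    ζ<e = subst (at ζ k <_) (sym (here (step-decAt (η m) r))) (s≤s (path-≤ rest k))
    -- With equal offsets both chains would end at the same embedding, although one lowers the
    -- letter at `k` and the other keeps it.
    a<c : a < c
    a<c = ≤∧≢⇒< (s≤s⁻¹ (sh-least sh (suc c) (≤-trans (subst (1 ≤_) (sym (sh-suc shζ)) vt1) (path-≤ path (suc c)))))
      λ a≡c → <⇒≢ ζ<e (trans (same a≡c k) (first-kept m<t t≤n nsd k k<l r))
      where
      same : a ≡ c → ∀ p → at ζ p ≡ e (suc t) p
      same a≡c p with split a p
      ... | inj₁ p≤a        = trans (proj₂ shζ p (subst (p ≤_) a≡c p≤a)) (sym (proj₂ sht p p≤a))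
      ... | inj₂ (q , refl) = trans (cong (λ x → at ζ (x + suc q)) a≡c) (trans (proj₁ shζ (suc q)) (sym (proj₁ sht (suc q))))
    d = c ∸ suc a
    c≡ : a + suc d ≡ c
    c≡ = trans (+-suc a d) (m+[n∸m]≡n a<c)
    shζ' : Sh (a + suc d) (at ζ) (at (v (suc t)))
    shζ' = subst (λ x → Sh x (at ζ) (at (v (suc t)))) (sym c≡) shζ
    len : suc d + length (v (suc t)) ≤ length (v m)
    len = sh-length-≤ (v m) (v (suc t)) (path-≤ path) sh wt shζ' (nonempty {v (suc t)} vt1)
    letters : ∀ q → at (v (suc t)) q ≤ at (v m) (suc d + q)
    letters = sh-at-≤ (v m) (v (suc t)) (path-≤ path) sh shζ'
    final = final-step m<t t≤n nsd sh sht (nonempty {v (suc t)} vt1) (≤-trans (s≤s (m≤n+m _ d)) len)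

  minimal-proper : ∀ {i j i' j'} → MinSkipped u w n v ls i j → i ≤ i' → j' ≤ j → j ≤ n → i < i' ⊎ j' < j →
    ¬ Skipped u w n v ls i' j'
  minimal-proper {i} {j} {i'} {j'} ms i≤i' j'≤j j≤n proper sk =
    proj₂ ms i' j' sk ((λ { x (k , a , b , eq) → k , ≤-<-trans i≤i' a , <-≤-trans b j'≤j , eq }) , missing proper)
    where
    i'<j' = proj₁ sk
    missing : i < i' ⊎ j' < j → ∃[ x ] (InInt v i j x × ¬ InInt v i' j' x)
    missing (inj₁ i<i') = v (suc i) , (suc i , ≤-refl , 1+i<j , refl) , out
      where
      1+i<j : suc i < j
      1+i<j = ≤-<-trans i<i' (<-≤-trans i'<j' j'≤j)
      out : ¬ InInt v i' j' (v (suc i))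
      out (k , a , b , eq) with v-injective (≤-trans (<⇒≤ b) (≤-trans j'≤j j≤n)) (≤-trans (<⇒≤ 1+i<j) j≤n) eq
      ... | refl = 1+n≰n (≤-trans a i<i')
    missing (inj₂ j'<j) = v j' , (j' , ≤-<-trans i≤i' i'<j' , j'<j , refl) , out
      where
      out : ¬ InInt v i' j' (v j')
      out (k , a , b , eq) with v-injective (≤-trans (<⇒≤ b) (≤-trans j'≤j j≤n)) (≤-trans j'≤j j≤n) eq
      ... | refl = 1+n≰n b

  -- Single strong descents are minimally skipped

  condA⇒minimal : ∀ {i j} → j ≤ n → CondA v ls i j → MinSkipped u w n v ls i j
  condA⇒minimal {i} h (refl , d , ne) = descent-skipped h d (λ tt → ne (TT⇒≡ h d tt)) , minimal
    where
    middle : ∀ {k} → i < k → k < suc (suc i) → k ≡ suc i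
    middle a b = ≤-antisym (s≤s⁻¹ b) a
    -- A skipped interval is nonempty, so inside a one-word interval it is everything.
    minimal : ∀ i' j' → Skipped u w n v ls i' j' →
      ¬ ((∀ x → InInt v i' j' x → InInt v i (suc (suc i)) x) × (∃[ x ] (InInt v i (suc (suc i)) x × ¬ InInt v i' j' x)))
    minimal i' j' (_ , _ , (x , inx) , _) (sub , (y , (k , a , b , eq) , out)) with sub x inx
    ... | (k' , a' , b' , eq') with middle a b | middle a' b'
    ...   | refl | refl = out (subst (InInt v i' j') (trans (sym eq') eq) inx)

  -- Minimally skipped intervals without strong descents satisfy (b)

  module Forward {i j a d} (i<j' : i < j) (j<n : suc j ≤ n) (ms : MinSkipped u w n v ls i (suc j))
                 (nsd : NSD i (suc j)) (sh : Sh a (e i) (at (v i))) (lz≡ : 1 ≤ at (v i) 1 → lz (η i) ≡ a)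
                 (sh-y : Sh a (e (suc j)) (at (v (suc j)))) (a<l : suc a < l i)
                 (kept : e (suc j) (suc a) ≡ e i (suc a)) (pos : 1 ≤ e (suc j) (suc a)) (nf : NF (at (v (suc j))))
                 (len : suc d + length (v (suc j)) ≤ length (v i))
                 (letters : ∀ q → at (v (suc j)) q ≤ at (v i) (suc d + q)) where

    W = v i
    y = v (suc j)
    i<j : i < suc j
    i<j = ≤-trans i<j' (n≤1+n j)
    i≤n : i ≤ n
    i≤n = ≤-trans (<⇒≤ i<j) j<n
    y≤W : ∀ q → at y q ≤ at W q
    y≤W = at-mono (<⇒≤ i<j) j<n sh sh-y
    y1 : 1 ≤ at y 1
    y1 = subst (1 ≤_) (sh-suc sh-y) pos
    y<W : length y < length W
    y<W = ≤-trans (s≤s (m≤n+m (length y) d)) len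
    final = final-step i<j j<n nsd sh sh-y (nonempty {y} y1) y<W

    before-last : v j ≡ y ++ 1 ∷ []
    before-last = rep-unique (rep (<⇒≤ j<n)) (word-snoc (word j<n) , a ,
      sh-snoc y sh-y (proj₁ (proj₂ final)) (λ q ne → sym (there (st j j<n) q (λ r → ne (trans r (proj₁ final))))))

    -- Otherwise y1 also embeds there, and already the interval ending at y1 is skipped.
    no-inner : ∀ c → suc c + length y < length W → (∀ q → 1 ≤ q → q ≤ length y → at y q ≤ at W (suc c + q)) → ⊥
    no-inner c lt le = minimal-proper ms ≤-refl (n≤1+n j) j<n (inj₂ ≤-refl)
      (skipped-offset i<j' (<⇒≤ j<n) (subst (λ x → NF (at x)) (sym before-last) nf') sh
        (subst (λ x → suc c + length x ≤ length W) (sym before-last)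
           (subst (_≤ length W) (sym (trans (cong (suc c +_) (length-snoc y 1)) (+-suc (suc c) (length y)))) lt))
        (subst (λ x → ∀ q → 1 ≤ q → q ≤ length x → at x q ≤ at W (suc c + q)) (sym before-last) le') a<l)
      where
      nf' : NF (at (y ++ 1 ∷ []))
      nf' = let (q , h) = nf in q , subst (2 ≤_) (sym (at-snoc-≤ y 1 q (at-pos⇒≤ y q (<⇒≤ h)))) h
      le' : ∀ q → 1 ≤ q → q ≤ length (y ++ 1 ∷ []) → at (y ++ 1 ∷ []) q ≤ at W (suc c + q)
      le' q 1≤q q≤ with m≤n⇒m<n∨m≡n (subst (q ≤_) (length-snoc y 1) q≤)
      ... | inj₁ q< = subst (_≤ at W (suc c + q)) (sym (at-snoc-≤ y 1 q (s≤s⁻¹ q<))) (le q 1≤q (s≤s⁻¹ q<))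
      ... | inj₂ refl = subst (_≤ at W (suc c + q)) (sym (at-snoc-last y 1))
              (word-at (word i≤n) (suc c + q) (s≤s z≤n) (subst (_≤ length W) (sym (+-suc (suc c) (length y))) lt))

    len≡ : suc d + length y ≡ length W
    len≡ with m≤n⇒m<n∨m≡n len
    ... | inj₂ eq = eq
    ... | inj₁ lt = ⊥-elim (no-inner d lt (λ q _ _ → letters q))

    outer : Outer y W
    outer = y<W , (<⇒≤ y<W , λ k _ _ → y≤W k) , (<⇒≤ y<W , λ k _ _ → subst (λ x → at y k ≤ at W (x + k)) d≡ (letters k))
      where
      d≡ : suc d ≡ length W ∸ length y
      d≡ = trans (sym (m+n∸n≡m (suc d) (length y))) (cong (_∸ length y) len≡)

    maxOuter : MaxOuter y W
    maxOuter = outer , maximal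
      where
      maximal : ∀ q → IsWord q → Outer q W → y ≼ q → ¬ (length y < length q)
      -- `y` sits at offset `suc o` in `q`; the copy of `q` at the start of `W` carries it along.
      maximal q _ (q<W , (_ , pre) , (_ , suf)) (suc o , l≤ , le) lt =
        no-inner o (≤-<-trans l≤ q<W) λ r 1≤r r≤ →
          ≤-trans (le r 1≤r r≤) (pre (suc o + r) (s≤s z≤n) (≤-trans (+-monoʳ-≤ (suc o) r≤) l≤))
      -- `y` is a prefix of `q`. In the copy of `q` at the end of `W` it stops before the end of
      -- `W`, because `q` is longer.
      maximal q _ (q<W , (_ , pre) , (_ , suf)) (zero , l≤ , le) lt with length W ∸ length q in eq
      ... | zero  = 1+n≰n (≤-trans q<W (m∸n≡0⇒m≤n eq))
      ... | suc c = no-inner c (subst (suc c + length y <_) (trans (cong (_+ length q) (sym eq)) (m∸n+n≡m (<⇒≤ q<W))) (+-monoʳ-< (suc c) lt))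
                      λ r 1≤r r≤ → ≤-trans (le r 1≤r r≤) (suf r 1≤r (≤-trans r≤ l≤))

    i<n = <-≤-trans i<j j<n

    K = l i ∸ a
    lK : l i ≡ a + K
    lK = sym (m+[n∸m]≡n (≤-trans (n≤1+n a) (<⇒≤ a<l)))

    principalIndex : IsPrincipalIndex W y K
    principalIndex = subst₂ _<_ (proj₁ sh-y K) (proj₁ sh K) (subst (λ x → e (suc j) x < e i x) lK
        (≤-<-trans (mono i<j j<n (l i)) (≤-reflexive (sym (here (st i i<n)))))) ,
      red⇒redWord (word i≤n) (sh-red↓ sh (subst (Red (e i)) lK (reducible i<n))) , minimal
      where
      -- Reducible letters left of `l i` are kept to the end by `first-kept`, so `y` has the same
      -- letters there.
      minimal : ∀ k → k < K → ¬ (at y k < at W k × RedWord W k)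
      minimal k k<K (lt , r) = <⇒≢ lt (trans (sym (proj₁ sh-y k)) (trans
        (first-kept i<j j<n nsd (a + k) (subst (a + k <_) (sym lK) (+-monoʳ-< a k<K)) (sh-red↑ sh (redWord⇒red (word i≤n) r)))
        (proj₁ sh k)))

    sh₁ : Sh a (e (suc i)) (at (v (suc i)))
    sh₁ = same-offset (n≤1+n i) i<j j<n sh pos

    -- The 1 removed in the last step is still present in `v (suc i)`, so this word is longer than
    -- `y`, and a suffix embedding of `y` avoids its first letter. The interval starting at `suc i`
    -- would then be skipped too.
    not-suffix : ¬ Suffix y (v (suc i))
    not-suffix (y≤v , le) with length (v (suc i)) ∸ length y in eq
    ... | zero  = 1+n≰n (≤-trans (at-pos⇒≤ (v (suc i)) (suc (length y)) longer) (m∸n≡0⇒m≤n eq))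
      where
      longer : 1 ≤ at (v (suc i)) (suc (length y))
      longer = subst (1 ≤_) (trans (cong (e (suc i)) (sym (+-suc a (length y)))) (proj₁ sh₁ (suc (length y))))
        (≤-trans (≤-reflexive (sym (proj₁ (proj₂ final)))) (mono i<j' (<⇒≤ j<n) _))
    ... | suc c = minimal-proper ms (n≤1+n i) ≤-refl j<n (inj₁ ≤-refl)
      (skipped-offset (s≤s i<j') j<n nf sh₁
        (≤-reflexive (trans (cong (_+ length y) (sym eq)) (m∸n+n≡m y≤v))) le
        (≤∧≢⇒< (sh-least sh₁ _ (red-pos (reducible 1+i<n))) untouched))
      where
      1+i<n : suc i < n
      1+i<n = <-≤-trans (s≤s i<j') j<n
      -- The first letter has the same value in `e i` and `e (suc j)`, so the second reduction lies
      -- strictly to its right.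
      untouched : suc a ≢ l (suc i)
      untouched eq' = 1+n≰n (≤-trans (≤-trans (s≤s (≤-trans (≤-reflexive (sym kept)) (mono (s≤s i<j') j<n (suc a))))
        (≤-reflexive (sym (subst (λ x → e (suc i) x ≡ suc (e (suc (suc i)) x)) (sym eq') (here (st (suc i) 1+i<n))))))
        (step-≤ (st i i<n) (suc a)))

    principal : PrincipalFactor y W
    principal = word j<n , nf⇒¬flat nf , maxOuter , K , principalIndex ,
      λ suf → not-suffix (subst (Suffix y) (strip-next i<n sh lK) suf)

    index : ∃[ k ] (IsPrincipalIndex W y k × l i ≡ lz (η i) + k)
    index = K , principalIndex , trans lK (cong (_+ K) (sym (lz≡ (≤-trans y1 (y≤W 1)))))

    N = suc j ∸ i
    iN : i + N ≡ suc j
    iN = m+[n∸m]≡n (<⇒≤ i<j)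

    -- As a chain in its own right, the segment starts at the word `v i` and not at its embedding in
    -- `w`, so all positions drop by the offset `a`.
    local : ℕ → ℕ
    local k = l (i + k) ∸ a

    ls' : List ℕ
    ls' = tab local N

    η' : ℕ → List ℕ
    η' zero    = W
    η' (suc k) = decAt (η' k) (local k)

    bound : ∀ {k} → k < N → i + k < n
    bound {k} h = <-≤-trans (subst (i + k <_) iN (+-monoʳ-< i h)) j<n

    bound' : ∀ {k} → k ≤ N → i + k ≤ n
    bound' {k} h = ≤-trans (subst (i + k ≤_) iN (+-monoʳ-≤ i h)) j<n

    l≡ : ∀ {k} → k < N → Sh a (e (i + k)) (at (η' k)) → l (i + k) ≡ a + local k
    l≡ {k} h s = sym (m+[n∸m]≡n (<⇒≤ (sh-least s _ (red-pos (reducible (bound h))))))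

    shifted : ∀ k → k ≤ N → Sh a (e (i + k)) (at (η' k))
    shifted zero    _ = subst (λ x → Sh a (e x) (at W)) (sym (+-identityʳ i)) sh
    shifted (suc k) h = subst (λ x → Sh a (e x) (at (η' (suc k)))) (sym (+-suc i k))
      (sh-step s (subst (λ x → Step (e (i + k)) x (e (suc (i + k)))) (l≡ h s) (st (i + k) (bound h)))
                 (step-decAt (η' k) (sh-red↓ s (subst (Red (e (i + k))) (l≡ h s) (reducible (bound h))))))
      where
      s = shifted k (<⇒≤ h)

    rep' : ∀ {k} → k ≤ N → Rep (at (η' k)) (v (i + k))
    rep' {k} h = sh-rep (shifted k h) (sh-0 (η' k)) (rep (bound' h))

    chainId : ChainId N (λ k → v (i + k)) ls' η'
    chainId = length-tab local N , cong v (sym (+-identityʳ i)) , (λ k h → rep-emb (η' k) (rep' h)) ,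
      λ k h → red⇒redEmb (η' k) (rep' (<⇒≤ h)) (subst (Red (at (η' k))) (sym (at-tab local h))
                (sh-red↓ (shifted k (<⇒≤ h)) (subst (Red (e (i + k))) (l≡ h (shifted k (<⇒≤ h))) (reducible (bound h))))) ,
              cong (decAt (η' k)) (sym (at-tab local h))

    η'-length : ∀ k → length (η' k) ≡ length W
    η'-length zero    = refl
    η'-length (suc k) = trans (length-decAt (η' k) _) (η'-length k)

    zeros = replicate (length W ∸ length y) 0

    end : η' N ≡ y ++ zeros
    end = at-ext (η' N) (y ++ zeros)
      (trans (η'-length N) (sym (trans (length-++ y) (trans (cong (length y +_) (length-replicate _)) (m+[n∸m]≡n (<⇒≤ y<W))))))
      λ p → trans (sym (proj₁ (shifted N ≤-refl) p)) (trans (cong (λ x → e x (a + p)) iN)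
              (trans (proj₁ sh-y p) (sym (at-++-zeros y _ p))))

    -- At the first difference a smaller chain would lower, for good, a letter left of the reduction
    -- in the given chain. The given chain keeps that letter, so the two cannot end at the same
    -- embedding.
    first-admissible : ∀ n₃ v₃ ls₃ η₃ → IsMaxChain y W n₃ v₃ → ChainId n₃ v₃ ls₃ η₃ → η₃ n₃ ≡ y ++ zeros → LexLe ls' ls₃
    first-admissible n₃ v₃ ls₃ η₃ mc₃ ci₃ end₃ with lex-cmp ls' ls₃
    ... | inj₁ le = le
    ... | inj₂ lt = ⊥-elim (<⇒≢ smaller (trans (cong (λ x → at x z) end₃) (trans (at-++-zeros y _ z) (trans (sym (proj₁ sh-y z))
              (trans (first-kept im<j j<n (NSD-⊆ (m≤m+n i m) ≤-refl nsd) (a + z) z< (sh-red↑ sm (subst (λ x → Red (at x) z) (agree m ≤-refl) (C₃.reducible m<n₃))))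
              (trans (proj₁ sm z) (cong (λ x → at x z) (sym (agree m ≤-refl)))))))))
      where
      module C₃ = Basics y W n₃ v₃ ls₃ η₃ mc₃ ci₃
      n≡ : n₃ ≡ N
      n≡ = +-cancelˡ-≡ i _ _ (trans (+-cancelʳ-≡ (sum y) (i + n₃) (suc j) (trans (+-assoc i n₃ (sum y))
        (trans (cong (i +_) (trans (cong (λ x → n₃ + sum x) (sym (proj₁ (proj₂ mc₃)))) (sym (C₃.sum-v ≤-refl))))
        (trans (sym (sum-v i≤n)) (sum-v j<n))))) (sym iN))
      fd = lex-first lt (trans (proj₁ ci₃) (trans n≡ (sym (length-tab local N))))
      m = proj₁ fd
      m<N : m < N
      m<N = subst (m <_) (length-tab local N) (proj₁ (proj₂ fd))
      m<n₃ : m < n₃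
      m<n₃ = subst (m <_) (sym n≡) m<N
      im<j : i + m < suc j
      im<j = subst (i + m <_) iN (+-monoʳ-< i m<N)
      z = at ls₃ (suc m)
      sm = shifted m (<⇒≤ m<N)
      agree : ∀ r → r ≤ m → η₃ r ≡ η' r
      agree zero    _ = C₃.η0
      agree (suc r) h = trans (C₃.next (<-trans h m<n₃))
        (cong₂ decAt (agree r (<⇒≤ h)) (trans (proj₁ (proj₂ (proj₂ fd)) r h) (at-tab local (<-trans h m<N))))
      z< : a + z < l (i + m)
      z< = subst (a + z <_) (sym (l≡ m<N sm)) (+-monoʳ-< a (subst (z <_) (at-tab local m<N) (proj₂ (proj₂ (proj₂ fd)))))
      smaller : at (η₃ n₃) z < at (η₃ m) z
      smaller = ≤-<-trans (C₃.mono m<n₃ ≤-refl z) (≤-reflexive (sym (here (C₃.st m m<n₃))))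

    condB : CondB n v ls η i (suc j)
    condB = principal , index , ls' , η' , chainId , end , first-admissible

  minimal⇒condB : ∀ {i j} → i < suc j → suc j ≤ n → MinSkipped u w n v ls i (suc j) → NSD i (suc j) →
    CondB n v ls η i (suc j)
  minimal⇒condB {i} {j} i<j j<n ms nsd = reduce (skipped-elim (proj₁ ms))
    where
    em : EmbOf (η i) (v i)
    em = emb (≤-trans (<⇒≤ i<j) j<n)
    conclude : ∀ {k ks ζ} → i < j → Path (η i) (k ∷ ks) ζ → k < l i → Rep (at ζ) (v (suc j)) → CondB n v ls η i (suc j)
    conclude i<j' P k<l r =
      let (sh-y , a<l , kept , pos , nf , d , len , letters) = analysis i<j j<n nsd (emb-offset em) P k<l r
      in Forward.condB i<j' j<n ms nsd (emb-offset em) (emb-lz em) sh-y a<l kept pos nf len letters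
    reduce : _ → CondB n v ls η i (suc j)
    reduce (m , k , ks , ζ , i≤m , m<j , P , k<l , r) with m≤n⇒m<n∨m≡n i≤m
    -- If the first difference came after `i`, the smaller interval starting at `m` would already be
    -- skipped.
    ... | inj₁ i<m  = ⊥-elim (minimal-proper ms i≤m ≤-refl j<n (inj₁ i<m) (skipped-intro (<⇒≤ m<j) j<n P k<l r))
    ... | inj₂ refl = conclude (s≤s⁻¹ m<j) P k<l r

  -- Condition (b) gives minimally skipped intervals

  module Backward {i j a K ls' η'} (i<j : i < suc j) (j<n : suc j ≤ n)
    (sh : Sh a (e i) (at (v i)))
    (¬flat : ¬ Flat (v (suc j))) (mo : MaxOuter (v (suc j)) (v i))
    (pi : IsPrincipalIndex (v i) (v (suc j)) K) (¬suf : ¬ Suffix (v (suc j)) (stripZ (decAt (v i) K)))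
    (lK : l i ≡ a + K) (ci' : ChainId (suc j ∸ i) (λ k → v (i + k)) ls' η')
    (end : η' (suc j ∸ i) ≡ v (suc j) ++ replicate (length (v i) ∸ length (v (suc j))) 0)
    (first : ∀ n₃ v₃ ls₃ η₃ → IsMaxChain (v (suc j)) (v i) n₃ v₃ → ChainId n₃ v₃ ls₃ η₃ →
      η₃ n₃ ≡ v (suc j) ++ replicate (length (v i) ∸ length (v (suc j))) 0 → LexLe ls' ls₃) where

    W = v i
    y = v (suc j)
    i≤n : i ≤ n
    i≤n = ≤-trans (<⇒≤ i<j) j<n
    i<n : i < n
    i<n = <-≤-trans i<j j<n
    N = suc j ∸ i
    iN : i + N ≡ suc j
    iN = m+[n∸m]≡n (<⇒≤ i<j)
    y<W : length y < length W
    y<W = proj₁ (proj₁ mo)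
    zeros = replicate (length W ∸ length y) 0
    nf : NF (at y)
    nf = ¬flat⇒nf (word j<n) ¬flat
    y1 : 1 ≤ at y 1
    y1 = first-letter (proj₁ nf) (word j<n) (<⇒≤ (proj₂ nf))

    bound : ∀ {k} → k < N → i + k < n
    bound {k} h = <-≤-trans (subst (i + k <_) iN (+-monoʳ-< i h)) j<n

    bound' : ∀ {k} → k ≤ N → i + k ≤ n
    bound' {k} h = ≤-trans (subst (i + k ≤_) iN (+-monoʳ-≤ i h)) j<n

    rep' : ∀ {k} → k ≤ N → Rep (at (η' k)) (v (i + k))
    rep' {k} h = emb-rep (word (bound' h)) (proj₁ (proj₂ (proj₂ ci')) k h)

    module _ {k} (h : k < N) (s : Sh a (e (i + k)) (at (η' k))) where

      local-red : Red (at (η' k)) (at ls' (suc k))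
      local-red = redEmb⇒red (η' k) (rep' (<⇒≤ h)) (proj₁ (proj₂ (proj₂ (proj₂ ci')) k h))

      step' : Step (e (i + k)) (a + at ls' (suc k)) (at (decAt (η (i + k)) (a + at ls' (suc k))))
      step' = step-decAt (η (i + k)) (sh-red↑ s local-red)

      sh' : Sh a (at (decAt (η (i + k)) (a + at ls' (suc k)))) (at (η' (suc k)))
      sh' = subst (λ x → Sh a (at (decAt (η (i + k)) (a + at ls' (suc k)))) (at x))
              (sym (proj₂ (proj₂ (proj₂ (proj₂ ci')) k h))) (sh-step s step' (step-decAt (η' k) local-red))

      -- Carried out on `η (i + k)`, the local reduction reaches the same word as the given chain,
      -- so `step-unique` identifies the positions.
      local-id : a + at ls' (suc k) ≡ l (i + k)
      local-id = step-unique (con (<⇒≤ (bound h))) step' (st (i + k) (bound h))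
        (sh-rep (sh-0 (η' (suc k))) sh' (rep' h))
        (subst (λ x → Rep (e (suc (i + k))) (v x)) (sym (+-suc i k)) (rep (bound h)))

      sh-next : Sh a (e (i + suc k)) (at (η' (suc k)))
      sh-next = subst (λ x → Sh a (at x) (at (η' (suc k))))
        (trans (cong (decAt (η (i + k))) local-id) (trans (sym (next (bound h))) (cong η (sym (+-suc i k))))) sh'

    shifted : ∀ k → k ≤ N → Sh a (e (i + k)) (at (η' k))
    shifted zero    _ = subst₂ (λ x z → Sh a (e x) (at z)) (sym (+-identityʳ i))
                          (sym (trans (proj₁ (proj₂ ci')) (cong v (+-identityʳ i)))) sh
    shifted (suc k) h = sh-next h (shifted k (<⇒≤ h))

    sh-y : Sh a (e (suc j)) (at y)
    sh-y = (λ p → trans (proj₁ s p) (at-++-zeros y _ p)) , proj₂ s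
      where
      s : Sh a (e (suc j)) (at (y ++ zeros))
      s = subst₂ (λ x z → Sh a (e x) (at z)) iN end (shifted N ≤-refl)

    pos : 1 ≤ e (suc j) (suc a)
    pos = subst (1 ≤_) (sym (sh-suc sh-y)) y1

    map-ls' : map (a +_) ls' ≡ seg i N
    map-ls' = seg-≡ (map (a +_) ls') N i (trans (length-map (a +_) ls') (proj₁ ci'))
      λ q h → trans (at-map ls' (subst (q <_) (sym (proj₁ ci')) h)) (local-id h (shifted q (<⇒≤ h)))
      where
      at-map : ∀ xs {q} → q < length xs → at (map (a +_) xs) (suc q) ≡ a + at xs (suc q)
      at-map (x ∷ xs) {zero}  _       = refl
      at-map (x ∷ xs) {suc q} (s≤s h) = at-map xs h

    -- Removing the first letter, or lowering it, keeps y as a suffix.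
    not-first : K ≢ 1
    not-first refl = ¬suf (lower (word i≤n) y<W (proj₂ (proj₂ (proj₁ mo))))
      where
      lower : ∀ {W} → IsWord W → length y < length W → Suffix y W → Suffix y (stripZ (decAt W 1))
      lower {suc zero ∷ W} (_ ∷ wW) (s≤s y≤) (_ , le) = subst (Suffix y) (sym (word-strip wW))
        (y≤ , λ k 1≤k k≤ → subst (at y k ≤_) (tail k 1≤k) (le k 1≤k k≤))
        where
        tail : ∀ k → 1 ≤ k → at (1 ∷ W) (suc (length W) ∸ length y + k) ≡ at W (length W ∸ length y + k)
        tail (suc k) _ = trans (cong (λ x → at (1 ∷ W) (x + suc k)) (+-∸-assoc 1 y≤))
          (subst (λ x → at (1 ∷ W) (suc x) ≡ at W x) (sym (+-suc (length W ∸ length y) k)) refl)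
      lower {suc (suc x) ∷ W} (_ ∷ wW) (s≤s y≤) (y≤' , le) = subst (Suffix y) (sym (word-strip (s≤s z≤n ∷ wW)))
        (y≤' , λ k 1≤k k≤ → subst (at y k ≤_) (tail k 1≤k) (le k 1≤k k≤))
        where
        tail : ∀ k → 1 ≤ k → at (suc (suc x) ∷ W) (suc (length W) ∸ length y + k) ≡ at (suc x ∷ W) (suc (length W) ∸ length y + k)
        tail (suc k) _ = subst (λ z → at (suc (suc x) ∷ W) (z + suc k) ≡ at (suc x ∷ W) (z + suc k)) (sym (+-∸-assoc 1 y≤))
          (subst (λ z → at (suc (suc x) ∷ W) (suc z) ≡ at (suc x ∷ W) (suc z)) (sym (+-suc (length W ∸ length y) k)) refl)

    a<l : suc a < l i
    a<l = subst (suc a <_) (sym lK) (subst (_≤ a + K) (trans (+-suc a 1) (cong suc (+-comm a 1)))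
            (+-monoʳ-≤ a (≤∧≢⇒< (proj₁ (proj₁ (proj₂ pi))) (≢-sym not-first))))

    skipped : Skipped u w n v ls i (suc j)
    skipped = skipped-offset i<j j<n nf sh (≤-reflexive (trans (cong (_+ length y) c≡) (m∸n+n≡m (<⇒≤ y<W))))
      (λ q 1≤q q≤ → subst (λ x → at y q ≤ at W (x + q)) (sym c≡) (proj₂ (proj₂ (proj₂ (proj₁ mo))) q 1≤q q≤)) a<l
      where
      c≡ : suc (pred (length W ∸ length y)) ≡ length W ∸ length y
      c≡ = suc-pred (length W ∸ length y) {{>-nonZero (m<n⇒0<n∸m y<W)}}

    -- Moved back by the offset `a`, such a sequence is a maximal chain from `v i` to `y` ending at
    -- the prefix embedding, and it would precede the first admissible one.
    no-earlier : ∀ {ks} → Path (η i) ks (η (suc j)) → ¬ LexLt ks (seg i N)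
    no-earlier {ks} P lt with path-↓ W sh P
    ... | (ks' , ζ , refl , P' , s) = contra (first (length ks') (chainOf W ks') ks' (state W ks')
              (path-maxChain (word i≤n) P' (sh-rep s (sh-0 ζ) (word j<n , a , sh-y))) (path-chainId (word i≤n) P')
              (trans (state-last W ks') (trans (path-runs P') same)))
      where
      lt' : LexLt ks' ls'
      lt' = lex-map a ks' ls' (subst (LexLt (map (a +_) ks')) (sym map-ls') lt)
      contra : LexLe ls' ks' → ⊥
      contra (inj₁ refl) = lex-irrefl lt'
      contra (inj₂ gt)   = lex-asym gt lt'
      same : ζ ≡ y ++ zeros
      same = at-ext ζ (y ++ zeros) (trans (path-length P') (sym (trans (length-++ y)
          (trans (cong (length y +_) (length-replicate _)) (m+[n∸m]≡n (<⇒≤ y<W))))))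
        λ p → trans (sym (proj₁ s p)) (trans (proj₁ sh-y p) (sym (at-++-zeros y _ p)))

    nsd : NSD i (suc j)
    nsd s i≤s s+2≤j d with ≡-dec _≟_ (v s) (v (suc (suc s)) ++ (1 ∷ 1 ∷ []))
    ... | yes eq = ≡⇒TT (≤-trans s+2≤j j<n) d eq
    ... | no ne  = ⊥-elim (no-earlier path lt)
      where
      h : suc (suc s) ≤ n
      h = ≤-trans s+2≤j j<n
      r : Red (e s) (l (suc s))
      r = descent-red h d (λ tt → ne (TT⇒≡ h d tt))
      -- All embeddings from here to `y` lie above a letter ≥ 2, so the swapped order ends at the
      -- very same embedding; the flat case, which would shift it, does not arise.
      S : Path (η s) (l (suc s) ∷ l s ∷ []) (η (suc (suc s)))
      S = swap-path h d r (swap-nf' (st s (<⇒≤ h)) (st (suc s) h) d (step-decAt (η s) r)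
            (nf-mono (mono s+2≤j j<n) (sh-nf sh-y nf)))
      D = s ∸ i
      D' = suc j ∸ suc (suc s)
      iD : i + D ≡ s
      iD = m+[n∸m]≡n i≤s
      sD' : suc (suc s) + D' ≡ suc j
      sD' = m+[n∸m]≡n s+2≤j
      path : Path (η i) (seg i D ++ (l (suc s) ∷ l s ∷ []) ++ seg (suc (suc s)) D') (η (suc j))
      path = path-++ (subst (λ x → Path (η i) (seg i D) (η x)) iD (seg-path i D (subst (_≤ n) (sym iD) (<⇒≤ (<⇒≤ h)))))
        (path-++ S (subst (λ x → Path (η (suc (suc s))) (seg (suc (suc s)) D') (η x)) sD'
          (seg-path (suc (suc s)) D' (subst (_≤ n) (sym sD') j<n))))
      N≡ : N ≡ D + suc (suc D')
      N≡ = +-cancelˡ-≡ i _ _ (trans iN (trans (sym sD') (sym (trans (sym (+-assoc i D (suc (suc D'))))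
             (trans (cong (_+ suc (suc D')) iD) (trans (+-suc s (suc D')) (cong suc (+-suc s D'))))))))
      lt : LexLt (seg i D ++ (l (suc s) ∷ l s ∷ []) ++ seg (suc (suc s)) D') (seg i N)
      lt = subst (LexLt _) (sym (trans (cong (seg i) N≡) (trans (seg-++ i D (suc (suc D')))
             (cong (λ x → seg i D ++ seg x (suc (suc D'))) iD)))) (lex-++ (seg i D) (lex-< d))

    final = final-step i<j j<n nsd sh sh-y (nonempty {y} y1) y<W

    -- y embeds in W at 0 and at c, so it is a prefix of the outer factor of length |W| - c.
    no-inner : ∀ c → suc c + length y < length W → (∀ q → at y q ≤ at W (suc c + q)) → ⊥
    no-inner c lt le = proj₂ mo Q wQ (Q<W , (<⇒≤ Q<W , pre) ,
        (<⇒≤ Q<W , suf)) (0 , <⇒≤ y<Q , emb-y) y<Q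
      where
      L = length W ∸ suc c
      c≤W : suc c ≤ length W
      c≤W = ≤-trans (m≤m+n (suc c) (length y)) (<⇒≤ lt)
      cL : suc c + L ≡ length W
      cL = m+[n∸m]≡n c≤W
      -- The pointwise minimum of the prefix and the suffix of length `L` is the largest outer
      -- factor of that length.
      f : ℕ → ℕ
      f p = at W (suc p) ⊓ at W (suc c + suc p)
      Q = tab f L
      len : length Q ≡ L
      len = length-tab f L
      Q<W : length Q < length W
      Q<W = subst₂ _<_ (sym len) cL (s≤s (m≤n+m L c))
      y<Q : length y < length Q
      y<Q = subst (length y <_) (sym len) (+-cancelˡ-< (suc c) _ _ (subst (suc c + length y <_) (sym cL) lt))
      wQ : IsWord Q
      wQ = word-tab f L λ p p<L → ⊓-glb
          (word-at (word i≤n) (suc p) (s≤s z≤n) (≤-trans p<L (m∸n≤m (length W) (suc c))))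
          (word-at (word i≤n) (suc c + suc p) (s≤s z≤n) (subst (suc c + suc p ≤_) cL (+-monoʳ-≤ (suc c) p<L)))
        where
        word-tab : ∀ f L → (∀ p → p < L → 1 ≤ f p) → IsWord (tab f L)
        word-tab f zero    h = []
        word-tab f (suc L) h = h 0 (s≤s z≤n) ∷ word-tab (f ∘ suc) L (λ p q → h (suc p) (s≤s q))
      pre : ∀ k → 1 ≤ k → k ≤ length Q → at Q k ≤ at W k
      pre (suc k) _ h = ≤-trans (≤-reflexive (at-tab f (subst (suc k ≤_) len h))) (m⊓n≤m _ _)
      suf : ∀ k → 1 ≤ k → k ≤ length Q → at Q k ≤ at W (length W ∸ length Q + k)
      suf (suc k) _ h = ≤-trans (≤-reflexive (at-tab f (subst (suc k ≤_) len h))) (≤-trans (m⊓n≤n _ _)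
        (≤-reflexive (cong (λ x → at W (x + suc k)) (sym (trans (cong (length W ∸_) len) (m∸[m∸n]≡n c≤W))))))
      emb-y : ∀ k → 1 ≤ k → k ≤ length y → at y k ≤ at Q k
      emb-y (suc k) _ h = ≤-trans (⊓-glb (at-mono (<⇒≤ i<j) j<n sh sh-y (suc k)) (le (suc k)))
        (≤-reflexive (sym (at-tab f (subst (suc k ≤_) len (≤-trans h (<⇒≤ y<Q))))))

    offset : ∀ {s} → i ≤ s → s ≤ suc j → Sh a (e s) (at (v s))
    offset i≤s s≤j = same-offset i≤s s≤j j<n sh pos

    -- Such an embedding of `v j'` induces one of `y` in `W`, which by `no-inner` must reach the end
    -- of `W`. If `j'` is below `suc j`, then `v j'` still has the 1 after `y` and does not fit; if
    -- `m` is above `i`, then `y` is a suffix of `v (suc i)`, against principality.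
    only-suffix : ∀ {m j' d} → i ≤ m → m ≤ j' → j' ≤ suc j → i < m ⊎ j' < suc j →
      suc d + length (v j') ≤ length (v m) → (∀ q → at (v j') q ≤ at (v m) (suc d + q)) → ⊥
    only-suffix {m} {j'} {d} i≤m m≤j' j'≤j proper len le =
      [ (λ lt → no-inner d lt λ q → ≤-trans (y≤ q) (≤-trans (le q) (vm≤ (suc d + q)))) , ends proper ]′ (m≤n⇒m<n∨m≡n y-fits)
      where
      m≤n : m ≤ n
      m≤n = ≤-trans (≤-trans m≤j' j'≤j) j<n
      shm : Sh a (e m) (at (v m))
      shm = offset i≤m (≤-trans m≤j' j'≤j)
      shj : Sh a (e j') (at (v j'))
      shj = offset (≤-trans i≤m m≤j') j'≤j
      y≤ : ∀ q → at y q ≤ at (v j') q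
      y≤ = at-mono j'≤j j<n shj sh-y
      vm≤ : ∀ q → at (v m) q ≤ at W q
      vm≤ = at-mono i≤m m≤n sh shm
      vm≤W : length (v m) ≤ length W
      vm≤W = word-length-≤ W (word m≤n) vm≤
      y-fits : suc d + length y ≤ length W
      y-fits = ≤-trans (+-monoʳ-≤ (suc d) (word-length-≤ (v j') (word j<n) y≤)) (≤-trans len vm≤W)
      ends : i < m ⊎ j' < suc j → suc d + length y ≡ length W → ⊥
      ends (inj₂ j'<) eq = 1+n≰n (≤-trans longer (+-cancelˡ-≤ (suc d) _ _ (≤-trans len (≤-trans vm≤W (≤-reflexive (sym eq))))))
        where
        longer : suc (length y) ≤ length (v j')
        longer = at-pos⇒≤ (v j') (suc (length y)) (subst (1 ≤_)
          (trans (cong (e j') (sym (+-suc a (length y)))) (proj₁ shj (suc (length y))))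
          (≤-trans (≤-reflexive (sym (proj₁ (proj₂ final)))) (mono (s≤s⁻¹ j'<) (<⇒≤ j<n) _)))
      ends (inj₁ i<m) eq = ¬suf (subst (Suffix y) (sym (strip-next i<n sh lK)) suffix)
        where
        sh₁ : Sh a (e (suc i)) (at (v (suc i)))
        sh₁ = offset (n≤1+n i) i<j
        v₁≥ : ∀ q → at (v m) q ≤ at (v (suc i)) q
        v₁≥ = at-mono i<m m≤n sh₁ shm
        len₁ : length (v (suc i)) ≡ length W
        len₁ = ≤-antisym (word-length-≤ W (word i<n) (at-mono (n≤1+n i) i<n sh sh₁))
          (≤-trans (≤-reflexive (sym eq)) (≤-trans (+-monoʳ-≤ (suc d) (word-length-≤ (v j') (word j<n) y≤))
            (≤-trans len (word-length-≤ (v (suc i)) (word m≤n) v₁≥))))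
        suffix : Suffix y (v (suc i))
        suffix = subst (length y ≤_) (sym len₁) (<⇒≤ y<W) , λ q _ _ →
          subst (λ x → at y q ≤ at (v (suc i)) (x + q))
            (trans (sym (m+n∸n≡m (suc d) (length y))) (cong (_∸ length y) (trans eq (sym len₁))))
            (≤-trans (≤-trans (y≤ q) (le q)) (v₁≥ (suc d + q)))

    minimal-inside : ∀ {i' j'} → i ≤ i' → j' ≤ suc j → i < i' ⊎ j' < suc j → ¬ Skipped u w n v ls i' j'
    minimal-inside {i'} {j'} i≤i' j'≤j proper sk = contra (skipped-elim sk)
      where
      contra : _ → ⊥
      contra (m , k , ks , ζ , i'≤m , m<j' , P , k<l , r) =
        let i≤m = ≤-trans i≤i' i'≤m
            m≤j' = ≤-trans (n≤1+n m) (<⇒≤ m<j')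
            (_ , _ , _ , _ , _ , d , len , le) = analysis (<⇒≤ m<j') (≤-trans j'≤j j<n) (NSD-⊆ i≤m j'≤j nsd)
                                                   (offset i≤m (≤-trans m≤j' j'≤j)) P k<l r
        in only-suffix i≤m m≤j' j'≤j ([ (λ lt → inj₁ (<-≤-trans lt i'≤m)) , inj₂ ]′ proper) len le

    minSkipped : MinSkipped u w n v ls i (suc j)
    minSkipped = skipped , minimal
      where
      minimal : ∀ i' j' → Skipped u w n v ls i' j' →
        ¬ ((∀ x → InInt v i' j' x → InInt v i (suc j) x) × (∃[ x ] (InInt v i (suc j) x × ¬ InInt v i' j' x)))
      minimal i' zero     (() , _) _
      minimal i' (suc j') sk@(i'<j' , j'<n , (_ , k , i'<k , k<j' , _) , _) (sub , (x , (k₀ , i<k₀ , k₀<j , eq₀) , out)) =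
        minimal-inside i≤i' j'≤j proper sk
        where
        i≤i' : i ≤ i'
        -- Nonemptiness puts `v (suc i')` and `v j'` into the inner interval; finding them in the
        -- outer one bounds both ends.
        i≤i' with sub (v (suc i')) (suc i' , ≤-refl , ≤-<-trans i'<k k<j' , refl)
        ... | (q , i<q , q<j , eq) with v-injective (≤-trans (<⇒≤ q<j) j<n) (<-≤-trans i'<j' j'<n) eq
        ...   | refl = s≤s⁻¹ i<q
        j'≤j : suc j' ≤ suc j
        j'≤j with sub (v j') (j' , <-≤-trans i'<k (s≤s⁻¹ k<j') , ≤-refl , refl)
        ... | (q , i<q , q<j , eq) with v-injective (≤-trans (<⇒≤ q<j) j<n) (<⇒≤ j'<n) eq
        ...   | refl = q<j
        proper : i < i' ⊎ suc j' < suc j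
        proper with m≤n⇒m<n∨m≡n i≤i' | m≤n⇒m<n∨m≡n j'≤j
        ... | inj₁ lt   | _         = inj₁ lt
        ... | inj₂ _    | inj₁ lt   = inj₂ lt
        ... | inj₂ refl | inj₂ refl = ⊥-elim (out (k₀ , i<k₀ , k₀<j , eq₀))

  -- Assembling the equivalence

  principalIndex-unique : ∀ {w p k k'} → IsPrincipalIndex w p k → IsPrincipalIndex w p k' → k ≡ k'
  principalIndex-unique {k = k} {k'} (a , b , c) (a' , b' , c') with <-cmp k k'
  ... | tri< lt _ _ = ⊥-elim (c' k lt (a , b))
  ... | tri≈ _ eq _ = eq
  ... | tri> _ _ gt = ⊥-elim (c k' gt (a' , b'))

  condB⇒minimal : ∀ {i j} → i < suc j → suc j ≤ n → CondB n v ls η i (suc j) → MinSkipped u w n v ls i (suc j)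
  condB⇒minimal {i} {j} i<j j<n
    ((_ , ¬flat , mo , k , pi , ¬suf) , (k' , pi' , lk') , ls' , η' , ci' , end , first) =
    Backward.minSkipped {K = k} {η' = η'} i<j j<n (emb-offset em) ¬flat mo pi ¬suf lK ci' end first
    where
    i≤n : i ≤ n
    i≤n = ≤-trans (<⇒≤ i<j) j<n
    em : EmbOf (η i) (v i)
    em = emb i≤n
    -- In (b) the principal index occurs under two separate quantifiers, as `k` and as `k'`; being
    -- least, the two agree.
    lK : l i ≡ proj₁ em + k
    lK = trans lk' (cong₂ _+_ (emb-lz em (word-at (word i≤n) 1 ≤-refl (≤-trans (s≤s z≤n) (proj₁ (proj₁ mo)))))
           (principalIndex-unique {w = v i} {p = v (suc j)} pi' pi))

  condA? : ∀ i j → Dec (CondA v ls i j)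
  condA? i j = j ≟ suc (suc i) ×-dec l (suc i) <? l i ×-dec ¬? (≡-dec _≟_ (v i) (v (suc (suc i)) ++ (1 ∷ 1 ∷ [])))

  minimal⇒cond : ∀ {i j} → i < suc j → suc j ≤ n → MinSkipped u w n v ls i (suc j) →
    CondA v ls i (suc j) ⊎ CondB n v ls η i (suc j)
  minimal⇒cond {i} {j} i<j j<n ms with condA? i (suc j)
  ... | yes A = inj₁ A
  ... | no ¬A = inj₂ (minimal⇒condB i<j j<n ms nsd)
    where
    nsd : NSD i (suc j)
    nsd s i≤s s+2≤j d with ≡-dec _≟_ (v s) (v (suc (suc s)) ++ (1 ∷ 1 ∷ []))
    ... | yes eq = ≡⇒TT (≤-trans s+2≤j j<n) d eq
    -- A strong descent is skipped on its own. It is either the whole interval, which is (a), or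
    -- properly contained in it, against minimality.
    ... | no ne with m≤n⇒m<n∨m≡n i≤s | m≤n⇒m<n∨m≡n s+2≤j
    ...   | inj₂ refl | inj₂ eq = ⊥-elim (¬A (sym eq , d , ne))
    ...   | inj₁ i<s  | _       = ⊥-elim (minimal-proper ms i≤s s+2≤j j<n (inj₁ i<s)
              (descent-skipped (≤-trans s+2≤j j<n) d (λ tt → ne (TT⇒≡ (≤-trans s+2≤j j<n) d tt))))
    ...   | inj₂ _    | inj₁ <j = ⊥-elim (minimal-proper ms i≤s s+2≤j j<n (inj₂ <j)
              (descent-skipped (≤-trans s+2≤j j<n) d (λ tt → ne (TT⇒≡ (≤-trans s+2≤j j<n) d tt))))

theorem3p9 : (u w : Word) (n : ℕ) (v : ℕ → Word) (ls : List ℕ) (η : ℕ → List ℕ) →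
    IsWord u → IsWord w → u ≼ w →
    IsMaxChain u w n v → ChainId n v ls η →
    (i j : ℕ) → i < j → j ≤ n →
    (MinSkipped u w n v ls i j ⇔ (CondA v ls i j ⊎ CondB n v ls η i j))
theorem3p9 u w n v ls η iu iw u≼w mc ci i (suc j) i<j j<n =
  mk⇔ (minimal⇒cond i<j j<n) [ condA⇒minimal j<n , condB⇒minimal i<j j<n ]′
  where
  open Given u w n v ls η iw mc ci
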